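{- For the ticker tape $\mathcal{X}$ of any independent set of $\mathcal{C}_n$, its period satisfies \[T(\mathcal{X})=\gcd(p,q)=\frac{\mathsf{Scale}(\mathcal{X})}{\deg(\mathcal{X})\,\mathrm{codeg}(\mathcal{X})}.\]
   Context: Let $n\ge2$ and $\mathcal{C}_n$ the cycle graph on $\mathbb{Z}_n=\{1,\dots,n\}$ with edges $\{i,i+1\}$ (mod $n$). Independent sets are binary vectors $x\in\{0,1\}^n$ with no two cyclically adjacent $1$s. The toggle $\tau_k$ changes $x_k$ from $1$ to $0$, from $0$ to $1$ if the result is independent, otherwise does nothing; $\tau=\tau_n\circ\cdots\circ\tau_1$, $x^{(i)}=\tau^i(x)$ for $i\in\mathbb{Z}$. The ticker tape $\mathcal{X}=(X_k)_{k\in\mathbb{Z}}$ has $X_{in+j}$ equal to the $j$-th entry of $x^{(i)}$ ($1\le j\le n$); $k$ is live if $X_k=1$. Its period $T(\mathcal{X})$ is the least $\ell>0$ with $X_{k+\ell}=X_k$ for all $k$. The successor $s$ sends live $k$ to the unique live element of $\{k+2,k+n+1\}$; the co-successor $c$ to the unique live element of $\{k+2n-2,k+2n-1\}$ (bijections on live entries). Snakes/co-snakes are orbits of $s$/$c$; $\alpha$, $\beta$ are their numbers. Step $k\to s(k)$ has type $E$ if $s(k)=k+2$, $D$ if $s(k)=k+n+1$; step $k\to c(k)$ has type $S$ if $c(k)=k+2n-1$, $L$ if $c(k)=k+2n-2$. The slither from live $k$ is the word of step types of $k\to s(k)\to\dots\to s^\beta(k)$; the co-slither from $k$ the word of step types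 of $k\to c(k)\to\dots\to c^\alpha(k)$. $\deg(\mathcal{X})$ is the length of the slither divided by its period as a cyclic word, and $\mathrm{codeg}(\mathcal{X})$ the length of the co-slither divided by its period as a cyclic word (independent of $k$). Write the slither from $k$ as $P^{\deg(\mathcal{X})}$ and the co-slither as $Q^{\mathrm{codeg}(\mathcal{X})}$, and set $p=s^{|P|}(k)-k$, $q=c^{|Q|}(k)-k$ (independent of $k$). The scale is $\mathsf{Scale}(\mathcal{X})=s^\beta(k)-k=c^\alpha(k)-k$ (independent of live $k$). -}

module Defs where

open import Data.Bool using (Bool; true; false; if_then_else_; not; _∧_)
open import Data.Nat as ℕ using (ℕ; zero; suc; NonZero)
import Data.Nat.DivMod as ℕD
import Data.Bool.ListAction as BLA
open import Data.Fin as Fin using (Fin; toℕ)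
open import Data.List as List using (List; []; _∷_; length; take; drop; _++_; allFin; reverse; foldl)
open import Data.Integer as ℤ using (ℤ; +_; -[1+_]; _-_)
import Data.Integer.DivMod as ℤD
open import Data.Product using (Σ; ∃; _×_; _,_)
open import Data.Sum using (_⊎_)
open import Relation.Nullary using (¬_; does)
open import Relation.Binary.PropositionalEquality using (_≡_)

-- Configurations on the cycle C_n.  Vertex j ∈ {1,…,n} of the paper is
-- the element (j-1) of Fin n.

Config : ℕ → Set
Config n = Fin n → Bool

module _ (n : ℕ) .{{_ : NonZero n}} where

  nxt : Fin n → Fin n
  nxt i = (toℕ i ℕ.+ 1) ℕD.mod n

  prv : Fin n → Fin n
  prv i = (toℕ i ℕ.+ (n ℕ.∸ 1)) ℕD.mod n

  Independent : Config n → Set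
  Independent x = ∀ i → x i ≡ true → x (nxt i) ≡ false

  isIndB : Config n → Bool
  isIndB x = BLA.and (List.map (λ i → not (x i ∧ x (nxt i))) (allFin n))

  setAt : Fin n → Bool → Config n → Config n
  setAt k b x i = if does (i Fin.≟ k) then b else x i

  toggle : Fin n → Config n → Config n
  toggle k x with x k
  ... | true  = setAt k false x
  ... | false = if isIndB (setAt k true x) then setAt k true x else x

  tau : Config n → Config n
  tau x = foldl (λ y k → toggle k y) x (allFin n)

  -- τ⁻¹ = τ_1 ∘ ⋯ ∘ τ_n (τ_n applied first); each toggle is an involution
  -- on independent sets, so this is the inverse of τ there.
  tauInv : Config n → Config n
  tauInv x = foldl (λ y k → toggle k y) x (reverse (allFin n))

  iterN : (Config n → Config n) → ℕ → Config n → Config n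
  iterN f zero    x = x
  iterN f (suc m) x = f (iterN f m x)

  orbitAt : Config n → ℤ → Config n
  orbitAt x (+ m)      = iterN tau m x
  orbitAt x -[1+ m ]   = iterN tauInv (suc m) x

  -- ticker tape: X_{i n + j} = j-th entry of x^{(i)}, 1 ≤ j ≤ n;
  -- i.e. writing k - 1 = i n + r with 0 ≤ r < n, X_k = x^{(i)}_{r+1}.
  tape : Config n → ℤ → Bool
  tape x k = orbitAt x ((k - ℤ.1ℤ) ℤD./ℕ n) (((k - ℤ.1ℤ) ℤD.%ℕ n) ℕD.mod n)

data SnakeStep : Set where
  E D : SnakeStep

data CoStep : Set where
  S L : CoStep

iterℤ : (ℤ → ℤ) → ℕ → ℤ → ℤ
iterℤ f zero    k = k
iterℤ f (suc m) k = iterℤ f m (f k)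

module _ (n : ℕ) .{{_ : NonZero n}} (x : Config n) where

  private
    X = tape n x

  -- successor: the unique live element of {k+2, k+n+1}
  succ : ℤ → ℤ
  succ k = if X (k ℤ.+ + 2) then k ℤ.+ + 2 else k ℤ.+ + (n ℕ.+ 1)

  succType : ℤ → SnakeStep
  succType k = if X (k ℤ.+ + 2) then E else D

  -- co-successor: the unique live element of {k+2n-2, k+2n-1}
  cosucc : ℤ → ℤ
  cosucc k = if X (k ℤ.+ + (2 ℕ.* n ℕ.∸ 1)) then k ℤ.+ + (2 ℕ.* n ℕ.∸ 1)
             else k ℤ.+ + (2 ℕ.* n ℕ.∸ 2)

  cosuccType : ℤ → CoStep
  cosuccType k = if X (k ℤ.+ + (2 ℕ.* n ℕ.∸ 1)) then S else L

  slither : ℤ → ℕ → List SnakeStep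
  slither k zero    = []
  slither k (suc m) = succType k ∷ slither (succ k) m

  coslither : ℤ → ℕ → List CoStep
  coslither k zero    = []
  coslither k (suc m) = cosuccType k ∷ coslither (cosucc k) m

-- k and k' lie in the same orbit of the (increasing) bijection f on live entries
SameOrbit : (ℤ → ℤ) → ℤ → ℤ → Set
SameOrbit f k k' = ∃ λ m → (iterℤ f m k ≡ k') ⊎ (iterℤ f m k' ≡ k)

NumOrbits : (ℤ → Bool) → (ℤ → ℤ) → ℕ → Set
NumOrbits X f a =
  Σ (Fin a → ℤ) λ r →
    (∀ i → X (r i) ≡ true) ×
    (∀ i j → SameOrbit f (r i) (r j) → i ≡ j) ×
    (∀ k → X k ≡ true → ∃ λ i → SameOrbit f (r i) k)

IsPeriodOf : (ℤ → Bool) → ℕ → Set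
IsPeriodOf X ℓ = ∀ k → X (k ℤ.+ + ℓ) ≡ X k

IsMinPeriod : (ℤ → Bool) → ℕ → Set
IsMinPeriod X T = (0 ℕ.< T) × IsPeriodOf X T × (∀ ℓ → 0 ℕ.< ℓ → ℓ ℕ.< T → ¬ IsPeriodOf X ℓ)

module _ {A : Set} (eq : A → A → Bool) where

  listEq : List A → List A → Bool
  listEq []       []       = true
  listEq (a ∷ as) (b ∷ bs) = eq a b ∧ listEq as bs
  listEq _        _        = false

  rotate : ℕ → List A → List A
  rotate d w = drop d w ++ take d w

  cycPerAux : List A → ℕ → ℕ → ℕ
  cycPerAux w zero    d = d
  cycPerAux w (suc f) d = if listEq (rotate d w) w then d else cycPerAux w f (suc d)

  cycPeriod : List A → ℕ
  cycPeriod w = cycPerAux w (length w ℕ.∸ 1) 1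

eqSnake : SnakeStep → SnakeStep → Bool
eqSnake E E = true
eqSnake D D = true
eqSnake _ _ = false

eqCo : CoStep → CoStep → Bool
eqCo S S = true
eqCo L L = true
eqCo _ _ = false

divSafe : ℕ → ℕ → ℕ
divSafe m zero    = 0
divSafe m (suc d) = m ℕ./ suc d

-- deg, codeg, p, q, Scale (relative to a live k, with α, β the numbers of
-- snakes / co-snakes)

module _ (n : ℕ) .{{_ : NonZero n}} (x : Config n) (α β : ℕ) (k : ℤ) where

  lenP : ℕ
  lenP = cycPeriod eqSnake (slither n x k β)

  lenQ : ℕ
  lenQ = cycPeriod eqCo (coslither n x k α)

  deg : ℕ
  deg = divSafe (length (slither n x k β)) lenP

  codeg : ℕ
  codeg = divSafe (length (coslither n x k α)) lenQ

  pShift : ℤ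
  pShift = iterℤ (succ n x) lenP k - k

  qShift : ℤ
  qShift = iterℤ (cosucc n x) lenQ k - k

  Scale : ℤ
  Scale = iterℤ (succ n x) β k - k

{-# OPTIONS --safe #-}

-- The tape satisfies X(k+n) = nor (X k) (X(k+1)) (X(k+n-1)).  Locally this rule shows that s and c
-- commute on live entries and, more precisely, that c preserves the type of s-steps and s the type
-- of c-steps.  Following the snake below a gap shows that any two live u, v satisfy s^a u = c^b v
-- for some a, b ≥ 0.  Counting orbits then gives s^β k = c^α k, with β the least positive exponent
-- for which s^β k lies on the co-snake of k.
--
-- Since the snake word has period |P| and is invariant under c, s^|P| translates all live entries
-- by p, so p is a period of the tape; likewise q.  Conversely, writing s^a k = c^b (k + T), the
-- translation by T preserves types, so |P| divides a and |Q| divides b, and T = (a/|P|) p - (b/|Q|) q.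
-- Hence T = gcd(p, q).  With p = p' T and q = q' T, the translations s^(q'|P|) and c^(p'|Q|) agree,
-- so β divides q'|P|, that is, deg divides q'; together with deg p = codeg q and coprimality of
-- p' and q' this forces codeg = p'.
module Submission where

open import Defs
open import Data.Bool as Bool using (Bool; true; false; not; _∧_; _∨_; if_then_else_)
import Data.Bool.ListAction as BLA
open import Data.Nat as ℕ using (ℕ; zero; suc; z≤n; s≤s; NonZero; _%_; _≤_)
open import Data.Nat.Divisibility using (_∣_; divides; m%n≡0⇒n∣m; ∣-antisym; ∣⇒≤; ∣m+n∣m⇒∣n; ∣n⇒∣m*n; *-cancelʳ-∣)
open import Data.Nat.DivMod using (_mod_; m≡m%n+[m/n]*n; m%n<n; m<n⇒m%n≡m; m*n/n≡m; [m+n]%n≡m%n; n%n≡0)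
open import Data.Nat.Induction using (<-wellFounded)
import Data.Nat.GCD as ℕ-GCD
import Data.Nat.Properties as ℕₚ
import Data.Nat.Tactic.RingSolver as ℕ-Solver
open import Data.Integer as ℤ using (ℤ; +_; -[1+_]; _+_; _-_; _*_; 1ℤ; _/ℕ_; _%ℕ_)
open import Data.Integer.DivMod using (a≡a%ℕn+[a/ℕn]*n; n%ℕd<d)
open import Data.Integer.GCD using (gcd)
import Data.Integer.Properties as ℤₚ
import Data.Integer.Tactic.RingSolver as ℤ-Solver
open import Algebra.Bundles using (module AbelianGroup)
open import Algebra.Properties.Group (AbelianGroup.group ℤₚ.+-0-abelianGroup)
  using () renaming (∙-cancelʳ to ℤ-cancelʳ; ∙-cancelˡ to ℤ-cancelˡ)
open import Data.Fin as Fin using (Fin; toℕ)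
open import Data.Fin.Properties using (pigeonhole; injective⇒≤; toℕ-injective; toℕ-fromℕ<; toℕ<n)
open import Data.List as List using (List; []; _∷_; _++_; drop; take; length; allFin; reverse; foldl)
open import Data.List.Properties using (unfold-reverse)
open import Data.List.Membership.Propositional using (_∈_)
open import Data.List.Membership.Propositional.Properties using (∈-allFin)
open import Data.List.Relation.Unary.All as All using (All)
open import Data.List.Relation.Unary.AllPairs as AllPairs using (AllPairs)
import Data.List.Relation.Unary.AllPairs.Properties as AllPairsₚ
open import Data.List.Relation.Unary.Any using (here; there)
import Data.List.Relation.Unary.Any.Properties as Anyₚ
open import Data.Product using (∃; ∃₂; _×_; _,_; proj₁; proj₂)
open import Data.Sum using (_⊎_; inj₁; inj₂)
open import Data.Empty using (⊥)
open import Function using (flip)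
open import Induction.WellFounded using (Acc; acc)
open import Relation.Binary using (tri<; tri≈; tri>)
open import Relation.Nullary using (¬_; yes; no; contradiction)
open import Relation.Nullary.Decidable using (dec-true; dec-false)
open import Relation.Binary.PropositionalEquality
  using (_≡_; _≢_; refl; sym; trans; cong; cong₂; subst; subst₂; module ≡-Reasoning)

-- Commutation of s and c alone would be too weak. Invariance of the types is what counts, because
-- the displacement of an iterate is a sum of step sizes and so depends on the type word only. An
-- equality F^a u = G^b v therefore carries two facts at once: the F-word of u from position a on is
-- the F-word of v, and the two displacements differ by v - u. The closing arithmetic is read off
-- such equalities.
--
-- The counts enter through the action of one map on the orbits of the other. F permutes the orbits
-- of G, and does so transitively because all live entries are linked; hence it moves them in a
-- single cycle, whose length is the number of G-orbits. This is why a word of snake steps has the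
-- number of co-snakes as its length.
--
-- The recurrence is uniform in k, with no exception at the ends of a row: where a cyclic neighbour
-- wraps around, its tape position moves to an adjacent row, and this is exactly the row whose value
-- the sweep sees at that moment.

true≢false : true ≢ false
true≢false ()

¬true⇒false : ∀ {b} → b ≢ true → b ≡ false
¬true⇒false {true}  h = contradiction refl h
¬true⇒false {false} h = refl

iterℤ-snoc : ∀ f j k → iterℤ f (suc j) k ≡ f (iterℤ f j k)
iterℤ-snoc f zero    k = refl
iterℤ-snoc f (suc j) k = iterℤ-snoc f j (f k)

-- One stage on the way from `k` to a live entry at distance `d`: some live entry strictly after `k`
-- and not beyond the target is linked to `k`. The remainder `r` is smaller than `d`, which drives
-- the induction in `linked-forward`.
record LinkedBetween (X : ℤ → Bool) (f g : ℤ → ℤ) (k : ℤ) (d : ℕ) : Set where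
  constructor linkedBetween
  field
    {e r}  : ℕ
    split  : d ≡ suc e ℕ.+ r
    live   : X (k + + suc e) ≡ true
    linked : ∃₂ λ a b → iterℤ f a k ≡ iterℤ g b (k + + suc e)

-- The remainder of e modulo d satisfies P and lies below the least positive solution, so it is 0.
-- This serves periods of words, periods of the tape and return exponents alike.
least-divides : ∀ {P : ℕ → Set} {d} (0<d : 0 ℕ.< d) → (∀ {e} → P e → P ((e % d) {{ℕ.>-nonZero 0<d}})) →
                (∀ {e} → 0 ℕ.< e → e ℕ.< d → ¬ P e) → ∀ {e} → P e → d ∣ e
least-divides {P} {suc d} 0<d P-% least {e} Pe with e % suc d in r
... | zero  = m%n≡0⇒n∣m e (suc d) r
... | suc _ = contradiction (subst P r (P-% Pe)) (least (s≤s z≤n) (subst (ℕ._< suc d) r (m%n<n e (suc d))))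

-- Cyclic periods of words

-- Slithers are treated as prefixes of infinite sequences, so that rotating a word becomes shifting
-- an index.
tab : {A : Set} → (ℕ → A) → ℕ → List A
tab t zero    = []
tab t (suc N) = t 0 ∷ tab (λ j → t (suc j)) N

module _ {A : Set} where

  tab-cong : ∀ N {t u : ℕ → A} → (∀ j → t j ≡ u j) → tab t N ≡ tab u N
  tab-cong zero    h = refl
  tab-cong (suc N) h = cong₂ _∷_ (h 0) (tab-cong N (λ j → h (suc j)))

  length-tab : ∀ (t : ℕ → A) N → length (tab t N) ≡ N
  length-tab t zero    = refl
  length-tab t (suc N) = cong suc (length-tab _ N)

  drop-tab : ∀ (t : ℕ → A) d e → drop d (tab t (d ℕ.+ e)) ≡ tab (λ j → t (d ℕ.+ j)) e
  drop-tab t zero    e = refl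
  drop-tab t (suc d) e = drop-tab (λ j → t (suc j)) d e

  take-tab : ∀ (t : ℕ → A) d e → take d (tab t (d ℕ.+ e)) ≡ tab t d
  take-tab t zero    e = refl
  take-tab t (suc d) e = cong (t 0 ∷_) (take-tab (λ j → t (suc j)) d e)

  tab-++ : ∀ (t : ℕ → A) a b → tab t a ++ tab (λ j → t (a ℕ.+ j)) b ≡ tab t (a ℕ.+ b)
  tab-++ t zero    b = refl
  tab-++ t (suc a) b = cong (t 0 ∷_) (tab-++ (λ j → t (suc j)) a b)

  Periodic : (ℕ → A) → ℕ → Set
  Periodic t d = ∀ j → t (j ℕ.+ d) ≡ t j

  Periodic-* : ∀ {t d} → Periodic t d → ∀ q → Periodic t (q ℕ.* d)
  Periodic-* {t}     h zero    j = cong t (ℕₚ.+-identityʳ j)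
  Periodic-* {t} {d} h (suc q) j =
    trans (cong t (sym (ℕₚ.+-assoc j d (q ℕ.* d)))) (trans (Periodic-* h q (j ℕ.+ d)) (h j))

  Periodic-% : ∀ {t d e} .{{_ : NonZero d}} → Periodic t d → Periodic t e → Periodic t (e % d)
  Periodic-% {t} {d} {e} hd he j = begin
    t (j ℕ.+ e % d)                       ≡⟨ sym (Periodic-* hd (e ℕ./ d) (j ℕ.+ e % d)) ⟩
    t (j ℕ.+ e % d ℕ.+ e ℕ./ d ℕ.* d)     ≡⟨ cong t (ℕₚ.+-assoc j (e % d) _) ⟩
    t (j ℕ.+ (e % d ℕ.+ e ℕ./ d ℕ.* d))   ≡⟨ cong (λ z → t (j ℕ.+ z)) (sym (m≡m%n+[m/n]*n e d)) ⟩
    t (j ℕ.+ e)                           ≡⟨ he j ⟩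
    t j                                   ∎
    where open ≡-Reasoning

  Periodic-value : ∀ {t N} .{{_ : NonZero N}} → Periodic t N → ∀ j → t j ≡ t (j % N)
  Periodic-value {t} {N} h j = trans (cong t (m≡m%n+[m/n]*n j N)) (Periodic-* h (j ℕ./ N) (j % N))

  record LeastPeriod (t : ℕ → A) (p : ℕ) : Set where
    field
      positive : 0 ℕ.< p
      period   : Periodic t p
      least    : ∀ {e} → 0 ℕ.< e → e ℕ.< p → ¬ Periodic t e

    divides-period : ∀ {e} → Periodic t e → p ∣ e
    divides-period = least-divides positive (Periodic-% {{ℕ.>-nonZero positive}} period) least

  -- The d letters moved to the end are, by N-periodicity, the letters at positions N, ..., N + d -
  -- 1 of the sequence.
  rotate-tab : ∀ (eq : A → A → Bool) {t N d} → Periodic t N → d ℕ.≤ N →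
               rotate eq d (tab t N) ≡ tab (λ j → t (d ℕ.+ j)) N
  rotate-tab eq {t} {N} {d} h d≤N with N ℕ.∸ d | ℕₚ.m+[n∸m]≡n d≤N
  ... | e | refl = begin
    drop d (tab t (d ℕ.+ e)) ++ take d (tab t (d ℕ.+ e))      ≡⟨ cong₂ _++_ (drop-tab t d e) (take-tab t d e) ⟩
    tab (λ j → t (d ℕ.+ j)) e ++ tab t d                      ≡⟨ cong (tab (λ j → t (d ℕ.+ j)) e ++_) (tab-cong d wrap) ⟩
    tab (λ j → t (d ℕ.+ j)) e ++ tab (λ j → t (d ℕ.+ (e ℕ.+ j))) d ≡⟨ tab-++ (λ j → t (d ℕ.+ j)) e d ⟩
    tab (λ j → t (d ℕ.+ j)) (e ℕ.+ d)                         ≡⟨ cong (tab (λ j → t (d ℕ.+ j))) (ℕₚ.+-comm e d) ⟩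
    tab (λ j → t (d ℕ.+ j)) (d ℕ.+ e)                         ∎
    where
    open ≡-Reasoning
    wrap : ∀ j → t j ≡ t (d ℕ.+ (e ℕ.+ j))
    wrap j = trans (sym (h j)) (cong t (trans (ℕₚ.+-comm j (d ℕ.+ e)) (ℕₚ.+-assoc d e j)))

module _ {A : Set} (eq : A → A → Bool)
  (eq⁺ : ∀ a → eq a a ≡ true) (eq⁻ : ∀ {a b} → eq a b ≡ true → a ≡ b) where

  listEq-refl : ∀ w → listEq eq w w ≡ true
  listEq-refl []      = refl
  listEq-refl (a ∷ w) rewrite eq⁺ a = listEq-refl w

  listEq-tab⁻ : ∀ {t u : ℕ → A} N → listEq eq (tab t N) (tab u N) ≡ true → ∀ {j} → j ℕ.< N → t j ≡ u j
  listEq-tab⁻ {t} {u} (suc N) h j<N with eq (t 0) (u 0) in e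
  listEq-tab⁻ (suc N) h {zero}  j<N       | true = eq⁻ e
  listEq-tab⁻ (suc N) h {suc j} (s≤s j<N) | true = listEq-tab⁻ N h j<N

  module _ {t : ℕ → A} {N : ℕ} .{{_ : NonZero N}} (periodic : Periodic t N) where

    -- The test compares N letters only; since both the sequence and its shift have period N,
    -- agreement there is agreement everywhere.
    rotation⁻ : ∀ {d} → d ℕ.≤ N → listEq eq (rotate eq d (tab t N)) (tab t N) ≡ true → Periodic t d
    rotation⁻ {d} d≤N h j = begin
      t (j ℕ.+ d)       ≡⟨ cong t (ℕₚ.+-comm j d) ⟩
      t (d ℕ.+ j)       ≡⟨ Periodic-value {t = λ j → t (d ℕ.+ j)} (λ i → trans (cong t (sym (ℕₚ.+-assoc d i N))) (periodic (d ℕ.+ i))) j ⟩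
      t (d ℕ.+ j % N)   ≡⟨ listEq-tab⁻ N (subst (λ w → listEq eq w (tab t N) ≡ true) (rotate-tab eq periodic d≤N) h) (m%n<n j N) ⟩
      t (j % N)         ≡⟨ sym (Periodic-value periodic j) ⟩
      t j               ∎
      where open ≡-Reasoning

    rotation⁺ : ∀ {d} → d ℕ.≤ N → Periodic t d → listEq eq (rotate eq d (tab t N)) (tab t N) ≡ true
    rotation⁺ {d} d≤N h = subst (λ w → listEq eq w (tab t N) ≡ true)
      (trans (tab-cong N (λ j → trans (sym (h j)) (cong t (ℕₚ.+-comm j d)))) (sym (rotate-tab eq periodic d≤N)))
      (listEq-refl (tab t N))

    -- The invariant f + d = N makes the fuel run out exactly at d = N, where the search returns d
    -- untested; N is a period by assumption.
    cycPerAux-least : ∀ f d → f ℕ.+ d ≡ N → 0 ℕ.< d → (∀ {e} → 0 ℕ.< e → e ℕ.< d → ¬ Periodic t e) →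
                      LeastPeriod t (cycPerAux eq (tab t N) f d)
    cycPerAux-least zero    d refl 0<d least = record { positive = 0<d ; period = periodic ; least = least }
    cycPerAux-least (suc f) d e    0<d least with listEq eq (rotate eq d (tab t N)) (tab t N) in r
    ... | true  = record { positive = 0<d ; period = rotation⁻ d≤N r ; least = least }
      where
      d≤N : d ℕ.≤ N
      d≤N = subst (d ℕ.≤_) e (ℕₚ.m≤n+m d (suc f))
    ... | false = cycPerAux-least f (suc d) (trans (ℕₚ.+-suc f d) e) (s≤s z≤n) least′
      where
      d≤N : d ℕ.≤ N
      d≤N = subst (d ℕ.≤_) e (ℕₚ.m≤n+m d (suc f))
      least′ : ∀ {e} → 0 ℕ.< e → e ℕ.< suc d → ¬ Periodic t e
      least′ 0<e (s≤s e≤d) h with ℕₚ.m≤n⇒m<n∨m≡n e≤d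
      ... | inj₁ e<d  = least 0<e e<d h
      ... | inj₂ refl = true≢false (trans (sym (rotation⁺ d≤N h)) r)

    cycPeriod-least : LeastPeriod t (cycPeriod eq (tab t N))
    cycPeriod-least = subst (λ l → LeastPeriod t (cycPerAux eq (tab t N) (l ℕ.∸ 1) 1)) (sym (length-tab t N))
      (cycPerAux-least (N ℕ.∸ 1) 1 (ℕₚ.m∸n+n≡m (ℕₚ.n≢0⇒n>0 (ℕ.≢-nonZero⁻¹ N))) (s≤s z≤n) λ { (s≤s z≤n) (s≤s ()) })

-- Periods of the tape and the closing arithmetic

module _ {X : ℤ → Bool} where

  IsPeriodOf-* : ∀ {T} → IsPeriodOf X T → ∀ c → IsPeriodOf X (c ℕ.* T)
  IsPeriodOf-* {T} h zero    v = cong X (ℤₚ.+-identityʳ v)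
  IsPeriodOf-* {T} h (suc c) v =
    trans (cong X (sym (ℤₚ.+-assoc v (+ T) (+ (c ℕ.* T))))) (trans (IsPeriodOf-* h c (v + + T)) (h v))

  IsPeriodOf-% : ∀ {T d} .{{_ : NonZero T}} → IsPeriodOf X T → IsPeriodOf X d → IsPeriodOf X (d % T)
  IsPeriodOf-% {T} {d} hT hd v = begin
    X (v + + (d % T))                         ≡⟨ sym (IsPeriodOf-* hT (d ℕ./ T) (v + + (d % T))) ⟩
    X (v + + (d % T) + + (d ℕ./ T ℕ.* T))     ≡⟨ cong X (ℤₚ.+-assoc v (+ (d % T)) (+ (d ℕ./ T ℕ.* T))) ⟩
    X (v + + (d % T ℕ.+ d ℕ./ T ℕ.* T))       ≡⟨ cong (λ z → X (v + + z)) (sym (m≡m%n+[m/n]*n d T)) ⟩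
    X (v + + d)                               ≡⟨ hd v ⟩
    X v                                       ∎
    where open ≡-Reasoning

-- The hypothesis x p = y q → dF P ∣ x P is the only trace of the equality of the translations
-- s^(x P) and c^(y Q); without it dF and dG would only be determined up to a common factor.
period-arithmetic : ∀ {T p q P dF dG} → 0 ℕ.< T → 0 ℕ.< p → 0 ℕ.< dF ℕ.* P → T ∣ p → T ∣ q →
  (∃₂ λ a b → T ℕ.+ b ℕ.* q ≡ a ℕ.* p) → dF ℕ.* p ≡ dG ℕ.* q →
  (∀ x y → x ℕ.* p ≡ y ℕ.* q → dF ℕ.* P ∣ x ℕ.* P) →
  T ≡ ℕ-GCD.gcd p q × T ℕ.* (dF ℕ.* dG) ≡ dF ℕ.* p
period-arithmetic {zero} ()
period-arithmetic {suc _} {P = zero} {dF} _ _ 0<dFP = contradiction (subst (0 ℕ.<_) (ℕₚ.*-zeroʳ dF) 0<dFP) λ ()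
period-arithmetic {suc _} {P = suc _} {zero} _ _ ()
period-arithmetic {T@(suc _)} {P = P@(suc _)} {dF@(suc _)} {dG} _ 0<p _ T∣p@(divides p′ refl) T∣q@(divides q′ refl)
  (a , b , combination) scales coincidence
  with *-cancelʳ-∣ {m = dF} {n = q′} P (coincidence q′ p′ (ring q′ p′ T))
  where
  ring : ∀ q p t → q ℕ.* (p ℕ.* t) ≡ p ℕ.* (q ℕ.* t)
  ring = ℕ-Solver.solve-∀
... | divides t refl = T≡gcd , trans (ring T dF dG) (cong (dF ℕ.*_) (sym p≡))
  where
  p = p′ ℕ.* T
  q = t ℕ.* dF ℕ.* T
  ring : ∀ t f g → t ℕ.* (f ℕ.* g) ≡ f ℕ.* (g ℕ.* t)
  ring = ℕ-Solver.solve-∀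

  common-∣ : ∀ {c} → c ∣ p → c ∣ q → c ∣ T
  common-∣ {c} c∣p c∣q = ∣m+n∣m⇒∣n (subst (c ∣_) (trans (sym combination) (ℕₚ.+-comm T (b ℕ.* q))) (∣n⇒∣m*n a c∣p)) (∣n⇒∣m*n b c∣q)

  T≡gcd : T ≡ ℕ-GCD.gcd p q
  T≡gcd = ∣-antisym (ℕ-GCD.gcd-greatest T∣p T∣q) (common-∣ (ℕ-GCD.gcd[m,n]∣m p q) (ℕ-GCD.gcd[m,n]∣n p q))

  p≡dG*t*T : p ≡ dG ℕ.* (t ℕ.* T)
  p≡dG*t*T = ℕₚ.*-cancelˡ-≡ p (dG ℕ.* (t ℕ.* T)) dF (trans scales (rearrange dG t dF T))
    where
    rearrange : ∀ g t f T → g ℕ.* (t ℕ.* f ℕ.* T) ≡ f ℕ.* (g ℕ.* (t ℕ.* T))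
    rearrange = ℕ-Solver.solve-∀

  q≡dF*t*T : q ≡ dF ℕ.* (t ℕ.* T)
  q≡dF*t*T = rearrange t dF T
    where
    rearrange : ∀ t f T → t ℕ.* f ℕ.* T ≡ f ℕ.* (t ℕ.* T)
    rearrange = ℕ-Solver.solve-∀

  t≢0 : t ≢ 0
  t≢0 refl = ℕₚ.<⇒≢ 0<p (sym (trans p≡dG*t*T (ℕₚ.*-zeroʳ dG)))

  -- With q = dF t T, the scale identity gives p = dG t T. So t T is a common divisor of p and q,
  -- and divides T by the linear combination.
  t*T≤T : t ℕ.* T ℕ.≤ 1 ℕ.* T
  t*T≤T = subst (t ℕ.* T ℕ.≤_) (sym (ℕₚ.*-identityˡ T))
    (∣⇒≤ (common-∣ (divides dG p≡dG*t*T) (divides dF q≡dF*t*T)))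

  t≡1 : t ≡ 1
  t≡1 = ℕₚ.≤-antisym (ℕₚ.*-cancelʳ-≤ t 1 T t*T≤T) (ℕₚ.n≢0⇒n>0 t≢0)

  p≡ : p ≡ dG ℕ.* T
  p≡ = trans p≡dG*t*T (cong (dG ℕ.*_) (trans (cong (ℕ._* T) t≡1) (ℕₚ.*-identityˡ T)))

-- Commuting step maps on the live set

-- Common form of s and c, so that every argument about the pair can be reused with the two maps
-- exchanged. The laws are confined to live entries, the only ones on which s and c are meaningful.
record Mover (X : ℤ → Bool) : Set₁ where
  field
    f         : ℤ → ℤ
    {A}       : Set
    type      : ℤ → A
    size      : A → ℕ
    size>0    : ∀ a → 0 ℕ.< size a
    f-step    : ∀ {k} → X k ≡ true → f k ≡ k + + size (type k)
    f-live    : ∀ {k} → X k ≡ true → X (f k) ≡ true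
    injective : ∀ {u v} → X u ≡ true → X v ≡ true → f u ≡ f v → u ≡ v

  iter : ℕ → ℤ → ℤ
  iter = iterℤ f

  word : ℤ → ℕ → A
  word k j = type (iter j k)

  -- Kept in ℕ and defined as a sum over the word, which gives monotonicity in the exponent and, by
  -- `disp-cong`, dependence on the word alone.
  disp : ℕ → ℤ → ℕ
  disp zero    k = 0
  disp (suc a) k = size (type k) ℕ.+ disp a (f k)

  iter-+ : ∀ a b k → iter (a ℕ.+ b) k ≡ iter b (iter a k)
  iter-+ zero    b k = refl
  iter-+ (suc a) b k = iter-+ a b (f k)

  iter-swap : ∀ a b k → iter a (iter b k) ≡ iter b (iter a k)
  iter-swap a b k = trans (sym (iter-+ b a k)) (trans (cong (λ c → iter c k) (ℕₚ.+-comm b a)) (iter-+ a b k))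

  iter-live : ∀ a {k} → X k ≡ true → X (iter a k) ≡ true
  iter-live zero    l = l
  iter-live (suc a) l = iter-live a (f-live l)

  iter-injective : ∀ a {u v} → X u ≡ true → X v ≡ true → iter a u ≡ iter a v → u ≡ v
  iter-injective zero    lu lv e = e
  iter-injective (suc a) lu lv e = injective lu lv (iter-injective a (f-live lu) (f-live lv) e)

  iter-disp : ∀ a {k} → X k ≡ true → iter a k ≡ k + + disp a k
  iter-disp zero    {k} l = sym (ℤₚ.+-identityʳ k)
  iter-disp (suc a) {k} l = trans (iter-disp a (f-live l))
    (trans (cong (_+ + disp a (f k)) (f-step l)) (ℤₚ.+-assoc k (+ size (type k)) (+ disp a (f k))))

  disp-+ : ∀ a b k → disp (a ℕ.+ b) k ≡ disp a k ℕ.+ disp b (iter a k)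
  disp-+ zero    b k = refl
  disp-+ (suc a) b k = trans (cong (size (type k) ℕ.+_) (disp-+ a b (f k))) (sym (ℕₚ.+-assoc (size (type k)) _ _))

  disp-cong : ∀ a {u v} → (∀ j → word u j ≡ word v j) → disp a u ≡ disp a v
  disp-cong zero    h = refl
  disp-cong (suc a) h = cong₂ ℕ._+_ (cong size (h 0)) (disp-cong a (λ j → h (suc j)))

  a≤disp : ∀ a k → a ℕ.≤ disp a k
  a≤disp zero    k = z≤n
  a≤disp (suc a) k = ℕₚ.+-mono-≤ (size>0 (type k)) (a≤disp a (f k))

  disp-mono : ∀ {a b} → a ℕ.≤ b → ∀ k → disp a k ℕ.≤ disp b k
  disp-mono {a} {b} a≤b k = subst (λ c → disp a k ℕ.≤ disp c k) (ℕₚ.m+[n∸m]≡n a≤b)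
    (subst (disp a k ℕ.≤_) (sym (disp-+ a (b ℕ.∸ a) k)) (ℕₚ.m≤m+n _ _))

  disp-cancel-≤ : ∀ a b k → disp a k ℕ.≤ disp b k → a ℕ.≤ b
  disp-cancel-≤ a b k h with a ℕ.≤? b
  ... | yes a≤b = a≤b
  ... | no  a≰b = contradiction (begin-strict
      disp b k                            <⟨ ℕₚ.m<m+n (disp b k) (ℕₚ.<-≤-trans (ℕₚ.m<n⇒0<n∸m (ℕₚ.≰⇒> a≰b)) (a≤disp (a ℕ.∸ b) (iter b k))) ⟩
      disp b k ℕ.+ disp (a ℕ.∸ b) (iter b k) ≡⟨ sym (disp-+ b (a ℕ.∸ b) k) ⟩
      disp (b ℕ.+ (a ℕ.∸ b)) k            ≡⟨ cong (λ c → disp c k) (ℕₚ.m+[n∸m]≡n (ℕₚ.<⇒≤ (ℕₚ.≰⇒> a≰b))) ⟩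
      disp a k                            ≤⟨ h ⟩
      disp b k                            ∎) (ℕₚ.<-irrefl refl)
    where open ℕₚ.≤-Reasoning

  iter-disp⁺ : ∀ a {k d} → X k ≡ true → iter a k ≡ k + + d → disp a k ≡ d
  iter-disp⁺ a {k} l e = ℤₚ.+-injective (ℤ-cancelˡ k _ _ (trans (sym (iter-disp a l)) e))

  iter-fixed : ∀ a {k} → X k ≡ true → iter a k ≡ k → a ≡ 0
  iter-fixed a {k} l e = ℕₚ.n≤0⇒n≡0 (subst (a ℕ.≤_) (iter-disp⁺ a l (trans e (sym (ℤₚ.+-identityʳ k)))) (a≤disp a k))

  -- A symmetric substitute for `SameOrbit` that uses forward iterates only. It composes without
  -- case distinctions; on live entries injectivity cancels common last steps and leads back to
  -- `SameOrbit`.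
  Meets : ℤ → ℤ → Set
  Meets u v = ∃₂ λ i j → iter i u ≡ iter j v

  Meets-sym : ∀ {u v} → Meets u v → Meets v u
  Meets-sym (i , j , e) = j , i , sym e

  Meets-trans : ∀ {u v w} → Meets u v → Meets v w → Meets u w
  Meets-trans {u} {v} {w} (i , j , e) (i′ , j′ , e′) = i ℕ.+ i′ , j′ ℕ.+ j , (begin
    iter (i ℕ.+ i′) u    ≡⟨ iter-+ i i′ u ⟩
    iter i′ (iter i u)   ≡⟨ cong (iter i′) e ⟩
    iter i′ (iter j v)   ≡⟨ iter-swap i′ j v ⟩
    iter j (iter i′ v)   ≡⟨ cong (iter j) e′ ⟩
    iter j (iter j′ w)   ≡⟨ sym (iter-+ j′ j w) ⟩
    iter (j′ ℕ.+ j) w    ∎)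
    where open ≡-Reasoning

  SameOrbit⇒Meets : ∀ {u v} → SameOrbit f u v → Meets u v
  SameOrbit⇒Meets (m , inj₁ e) = m , 0 , e
  SameOrbit⇒Meets (m , inj₂ e) = 0 , m , sym e

  iter-≡⇒SameOrbit : ∀ i j {u v} → X u ≡ true → X v ≡ true → iter i u ≡ iter j v → SameOrbit f u v
  iter-≡⇒SameOrbit zero    j       lu lv e = j , inj₂ (sym e)
  iter-≡⇒SameOrbit (suc i) zero    lu lv e = suc i , inj₁ e
  iter-≡⇒SameOrbit (suc i) (suc j) {u} {v} lu lv e = iter-≡⇒SameOrbit i j lu lv
    (injective (iter-live i lu) (iter-live j lv) (trans (sym (iterℤ-snoc f i u)) (trans e (iterℤ-snoc f j v))))

  Meets⇒SameOrbit : ∀ {u v} → X u ≡ true → X v ≡ true → Meets u v → SameOrbit f u v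
  Meets⇒SameOrbit lu lv (i , j , e) = iter-≡⇒SameOrbit i j lu lv e

  word-+ : ∀ a k j → word k (a ℕ.+ j) ≡ word (iter a k) j
  word-+ a k j = cong type (iter-+ a j k)

  word-periodic : ∀ {k q} → Periodic (word k) q → ∀ j → word (iter q k) j ≡ word k j
  word-periodic {k} {q} h j = trans (sym (word-+ q k j)) (trans (cong (word k) (ℕₚ.+-comm q j)) (h j))

  disp-* : ∀ {k q} → Periodic (word k) q → ∀ c → disp (c ℕ.* q) k ≡ c ℕ.* disp q k
  disp-* h zero    = refl
  disp-* {k} {q} h (suc c) = trans (disp-+ q (c ℕ.* q) k)
    (cong (disp q k ℕ.+_) (trans (disp-cong (c ℕ.* q) (word-periodic h)) (disp-* h c)))

  -- Splitting a + q steps as a then q, or as q then a, gives the same total, and by periodicity the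
  -- a steps cover the same distance in both splittings.
  disp-along : ∀ {k q} → Periodic (word k) q → ∀ a → disp q (iter a k) ≡ disp q k
  disp-along {k} {q} h a = ℕₚ.+-cancelˡ-≡ (disp a k) _ _ (begin
    disp a k ℕ.+ disp q (iter a k)   ≡⟨ sym (disp-+ a q k) ⟩
    disp (a ℕ.+ q) k                 ≡⟨ cong (λ c → disp c k) (ℕₚ.+-comm a q) ⟩
    disp (q ℕ.+ a) k                 ≡⟨ disp-+ q a k ⟩
    disp q k ℕ.+ disp a (iter q k)   ≡⟨ cong (disp q k ℕ.+_) (disp-cong a (word-periodic h)) ⟩
    disp q k ℕ.+ disp a k            ≡⟨ ℕₚ.+-comm (disp q k) (disp a k) ⟩
    disp a k ℕ.+ disp q k            ∎)
    where open ≡-Reasoning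

  module _ {T : ℕ} (X-T : ∀ k → X (k + + T) ≡ X k) (type-T : ∀ k → type (k + + T) ≡ type k) where

    iter-T : ∀ j {k} → X k ≡ true → iter j (k + + T) ≡ iter j k + + T
    iter-T zero    l = refl
    iter-T (suc j) {k} l = trans (cong (iter j) f-T) (iter-T j (f-live l))
      where
      open ≡-Reasoning
      f-T : f (k + + T) ≡ f k + + T
      f-T = begin
        f (k + + T)                             ≡⟨ f-step (trans (X-T k) l) ⟩
        k + + T + + size (type (k + + T))       ≡⟨ cong (λ t → k + + T + + size t) (type-T k) ⟩
        k + + T + + size (type k)               ≡⟨ ℤₚ.+-assoc k (+ T) (+ size (type k)) ⟩
        k + (+ T + + size (type k))             ≡⟨ cong (_+_ k) (ℤₚ.+-comm (+ T) (+ size (type k))) ⟩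
        k + (+ size (type k) + + T)             ≡⟨ sym (ℤₚ.+-assoc k (+ size (type k)) (+ T)) ⟩
        k + + size (type k) + + T               ≡⟨ cong (_+ + T) (sym (f-step l)) ⟩
        f k + + T                               ∎

    word-T : ∀ {k} → X k ≡ true → ∀ j → word (k + + T) j ≡ word k j
    word-T {k} l j = trans (cong type (iter-T j l)) (type-T (iter j k))

module Commuting {X : ℤ → Bool} (F G : Mover X)
  (F-type : ∀ {k} → X k ≡ true → Mover.type F (Mover.f G k) ≡ Mover.type F k)
  (G-type : ∀ {k} → X k ≡ true → Mover.type G (Mover.f F k) ≡ Mover.type G k)
  where

  private
    module F = Mover F
    module G = Mover G

  f-g : ∀ {k} → X k ≡ true → F.f (G.f k) ≡ G.f (F.f k)
  f-g {k} l = begin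
    F.f (G.f k)                                          ≡⟨ F.f-step (G.f-live l) ⟩
    G.f k + + F.size (F.type (G.f k))                    ≡⟨ cong₂ (λ z t → z + + F.size t) (G.f-step l) (F-type l) ⟩
    k + + G.size (G.type k) + + F.size (F.type k)        ≡⟨ ℤₚ.+-assoc k _ _ ⟩
    k + (+ G.size (G.type k) + + F.size (F.type k))      ≡⟨ cong (_+_ k) (ℤₚ.+-comm (+ G.size (G.type k)) (+ F.size (F.type k))) ⟩
    k + (+ F.size (F.type k) + + G.size (G.type k))      ≡⟨ sym (ℤₚ.+-assoc k _ _) ⟩
    k + + F.size (F.type k) + + G.size (G.type k)        ≡⟨ sym (cong₂ (λ z t → z + + G.size t) (F.f-step l) (G-type l)) ⟩
    F.f k + + G.size (G.type (F.f k))                    ≡⟨ sym (G.f-step (F.f-live l)) ⟩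
    G.f (F.f k)                                          ∎
    where open ≡-Reasoning

  iter-g : ∀ a {k} → X k ≡ true → F.iter a (G.f k) ≡ G.f (F.iter a k)
  iter-g zero    l = refl
  iter-g (suc a) l = trans (cong (F.iter a) (f-g l)) (iter-g a (F.f-live l))

  iter-comm : ∀ a b {k} → X k ≡ true → F.iter a (G.iter b k) ≡ G.iter b (F.iter a k)
  iter-comm a zero    l = refl
  iter-comm a (suc b) l = trans (iter-comm a b (G.f-live l)) (cong (G.iter b) (iter-g a l))

  F-type-iter : ∀ b {k} → X k ≡ true → F.type (G.iter b k) ≡ F.type k
  F-type-iter zero    l = refl
  F-type-iter (suc b) l = trans (F-type-iter b (G.f-live l)) (F-type l)

  F-word-iter : ∀ b {k} → X k ≡ true → ∀ j → F.word (G.iter b k) j ≡ F.word k j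
  F-word-iter b l j = trans (cong F.type (iter-comm j b l)) (F-type-iter b (F.iter-live j l))

  -- G leaves F-words unchanged, so at the common entry the word of u, advanced by a, continues as
  -- the word of v. For u = v this says that a is a period of the word.
  F-word-linked : ∀ {a b u v} → X v ≡ true → F.iter a u ≡ G.iter b v → ∀ j → F.word u (j ℕ.+ a) ≡ F.word v j
  F-word-linked {a} {b} {u} {v} lv e j = trans (cong (F.word u) (ℕₚ.+-comm j a))
    (trans (F.word-+ a u j) (trans (cong (λ z → F.word z j) e) (F-word-iter b lv j)))

  Meets-iter : ∀ a {u v} → X u ≡ true → X v ≡ true → G.Meets u v → G.Meets (F.iter a u) (F.iter a v)
  Meets-iter a lu lv (i , j , e) = i , j , trans (sym (iter-comm a i lu)) (trans (cong (F.iter a) e) (iter-comm a j lv))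

  Meets-iter⁻ : ∀ a {u v} → X u ≡ true → X v ≡ true → G.Meets (F.iter a u) (F.iter a v) → G.Meets u v
  Meets-iter⁻ a lu lv (i , j , e) = i , j ,
    F.iter-injective a (G.iter-live i lu) (G.iter-live j lv) (trans (iter-comm a i lu) (trans e (sym (iter-comm a j lv))))

  -- Sharing a G-orbit leaves open which entry comes first. Both maps move to the right, so G can
  -- lead from F^a k back to k only if nothing has moved at all; then b = 0 serves.
  return : ∀ a {k} → X k ≡ true → G.Meets k (F.iter a k) → ∃ λ b → F.iter a k ≡ G.iter b k
  return a {k} l h with G.Meets⇒SameOrbit l (F.iter-live a l) h
  ... | b , inj₁ e = b , sym e
  ... | b , inj₂ e = 0 , cong (λ c → F.iter c k) a≡0
    where
    total : F.disp a k ℕ.+ G.disp b (F.iter a k) ≡ 0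
    total = ℤₚ.+-injective (ℤ-cancelˡ k _ _ (begin
      k + (+ F.disp a k + + G.disp b (F.iter a k))    ≡⟨ sym (ℤₚ.+-assoc k _ _) ⟩
      k + + F.disp a k + + G.disp b (F.iter a k)      ≡⟨ cong (_+ + G.disp b (F.iter a k)) (sym (F.iter-disp a l)) ⟩
      F.iter a k + + G.disp b (F.iter a k)            ≡⟨ sym (G.iter-disp b (F.iter-live a l)) ⟩
      G.iter b (F.iter a k)                           ≡⟨ e ⟩
      k                                               ≡⟨ sym (ℤₚ.+-identityʳ k) ⟩
      k + + 0                                         ∎))
      where open ≡-Reasoning
    a≡0 : a ≡ 0
    a≡0 = ℕₚ.n≤0⇒n≡0 (subst (a ℕ.≤_) (ℕₚ.m+n≡0⇒m≡0 _ total) (F.a≤disp a k))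

  Meets-multiple : ∀ {k d} → X k ≡ true → G.Meets k (F.iter d k) → ∀ q → G.Meets k (F.iter (q ℕ.* d) k)
  Meets-multiple         l h zero    = 0 , 0 , refl
  Meets-multiple {k} {d} l h (suc q) = G.Meets-trans h (subst (G.Meets (F.iter d k))
    (trans (F.iter-swap d (q ℕ.* d) k) (sym (F.iter-+ d (q ℕ.* d) k)))
    (Meets-iter d l (F.iter-live (q ℕ.* d) l) (Meets-multiple l h q)))

  -- F acts on the orbits of G, so once d returns k to its G-orbit, only the residue of the exponent
  -- modulo d matters.
  Meets-% : ∀ {k d} .{{_ : NonZero d}} → X k ≡ true → G.Meets k (F.iter d k) → ∀ a → G.Meets (F.iter (a % d) k) (F.iter a k)
  Meets-% {k} {d} l h a = subst (G.Meets (F.iter (a % d) k))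
    (trans (F.iter-swap (a % d) (a ℕ./ d ℕ.* d) k)
      (trans (sym (F.iter-+ (a % d) (a ℕ./ d ℕ.* d) k)) (cong (λ c → F.iter c k) (sym (m≡m%n+[m/n]*n a d)))))
    (Meets-iter (a % d) l (F.iter-live (a ℕ./ d ℕ.* d) l) (Meets-multiple l h (a ℕ./ d)))

  Linked : ℤ → ℤ → Set
  Linked u v = ∃₂ λ a b → F.iter a u ≡ G.iter b v

  Linked-trans : ∀ {u v w} → X v ≡ true → X w ≡ true → X u ≡ true → Linked u v → Linked v w → Linked u w
  Linked-trans {u} {v} {w} lv lw lu (a , b , e) (a′ , b′ , e′) = a ℕ.+ a′ , b′ ℕ.+ b , (begin
    F.iter (a ℕ.+ a′) u        ≡⟨ F.iter-+ a a′ u ⟩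
    F.iter a′ (F.iter a u)     ≡⟨ cong (F.iter a′) e ⟩
    F.iter a′ (G.iter b v)     ≡⟨ iter-comm a′ b lv ⟩
    G.iter b (F.iter a′ v)     ≡⟨ cong (G.iter b) e′ ⟩
    G.iter b (G.iter b′ w)     ≡⟨ sym (G.iter-+ b′ b w) ⟩
    G.iter (b′ ℕ.+ b) w        ∎)
    where open ≡-Reasoning

  module _ (next : ∀ {k} d → X k ≡ true → X (k + + suc d) ≡ true → LinkedBetween X F.f G.f k (suc d)) where

    linked-forward : ∀ {d} → Acc ℕ._<_ d → ∀ {u} → X u ≡ true → X (u + + d) ≡ true → Linked u (u + + d)
    linked-forward {zero}  _        {u} lu lv = 0 , 0 , sym (ℤₚ.+-identityʳ u)
    linked-forward {suc d} (acc rs) {u} lu lv with next d lu lv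
    ... | linkedBetween {e} {r} split live link = subst (Linked u) v≡
        (Linked-trans live (trans (cong X v≡) lv) lu link
          (linked-forward (rs (subst (r ℕ.<_) (sym split) (ℕₚ.m<n+m r (s≤s z≤n)))) live (trans (cong X v≡) lv)))
      where
      v≡ : u + + suc e + + r ≡ u + + suc d
      v≡ = trans (ℤₚ.+-assoc u (+ suc e) (+ r)) (cong (λ z → u + + z) (sym split))

    linked-all : ∀ {u v} → X u ≡ true → X v ≡ true → Linked u v
    linked-all {u} {v} lu lv = let a , b , e = to-w in a , N ℕ.+ b , trans e (sym (G.iter-+ N b v))
      where
      -- Stages run to the right only, so v is first pushed past u: each step of G gains at least 1,
      -- hence N steps suffice, and they are absorbed into the exponent of G.
      N = ℤ.∣ u - v ∣
      w = G.iter N v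
      lw : X w ≡ true
      lw = G.iter-live N lv
      u≤w : u ℤ.≤ w
      u≤w = begin
        u                    ≡⟨ ring u v ⟩
        v + (u - v)          ≤⟨ ℤₚ.+-monoʳ-≤ v (i≤+∣i∣ (u - v)) ⟩
        v + + N              ≤⟨ ℤₚ.+-monoʳ-≤ v (ℤ.+≤+ (G.a≤disp N v)) ⟩
        v + + G.disp N v     ≡⟨ sym (G.iter-disp N lv) ⟩
        w                    ∎
        where
        open ℤₚ.≤-Reasoning
        ring : ∀ u v → u ≡ v + (u - v)
        ring = ℤ-Solver.solve-∀
        i≤+∣i∣ : ∀ i → i ℤ.≤ + ℤ.∣ i ∣
        i≤+∣i∣ (+ n)     = ℤₚ.≤-refl
        i≤+∣i∣ -[1+ n ]  = ℤ.-≤+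
      w≡ : u + + ℤ.∣ w - u ∣ ≡ w
      w≡ = trans (cong (_+_ u) (ℤₚ.0≤i⇒+∣i∣≡i (ℤₚ.i≤j⇒0≤j-i u≤w))) (ring u w)
        where
        ring : ∀ u w → u + (w - u) ≡ w
        ring = ℤ-Solver.solve-∀
      to-w : Linked u w
      to-w = subst (Linked u) w≡ (linked-forward (<-wellFounded _) lu (trans (cong X w≡) lw))

  module Transitive (linked : ∀ {u v} → X u ≡ true → X v ≡ true → Linked u v) where

    -- Any live v lies on the G-orbit of some F^a k. Moving along F keeps the displacement over a
    -- period, and moving along G keeps the whole word.
    F-disp-const : ∀ {k v q} → X k ≡ true → X v ≡ true → Periodic (F.word k) q → F.disp q v ≡ F.disp q k
    F-disp-const {k} {v} {q} lk lv h with linked lk lv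
    ... | a , b , e = begin
      F.disp q v               ≡⟨ sym (F.disp-cong q (F-word-iter b lv)) ⟩
      F.disp q (G.iter b v)    ≡⟨ cong (F.disp q) (sym e) ⟩
      F.disp q (F.iter a k)    ≡⟨ F.disp-along h a ⟩
      F.disp q k               ∎
      where open ≡-Reasoning

    module Count {N : ℕ} (orbits : NumOrbits X G.f N) {k : ℤ} (l : X k ≡ true) where

      private
        rep = proj₁ orbits
        rep-live = proj₁ (proj₂ orbits)
        separated = proj₁ (proj₂ (proj₂ orbits))
        covering = proj₂ (proj₂ (proj₂ orbits))

      -- The N + 1 entries k, F k, ..., F^N k lie on N orbits of G, so two of them share one;
      -- injectivity cancels the common initial iterate.
      exists-return : ∃ λ d → 0 ℕ.< d × d ℕ.≤ N × G.Meets k (F.iter d k)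
      exists-return with pigeonhole (ℕₚ.n<1+n N) (λ i → proj₁ (covering (F.iter (toℕ i) k) (F.iter-live (toℕ i) l)))
      ... | i , j , i<j , eq = d , ℕₚ.m<n⇒0<n∸m i<j , ℕₚ.≤-trans (ℕₚ.m∸n≤m (toℕ j) (toℕ i)) (ℕ.s≤s⁻¹ (toℕ<n j)) ,
          Meets-iter⁻ (toℕ i) l (F.iter-live d l) (subst (G.Meets (F.iter (toℕ i) k)) j≡ meets)
        where
        d = toℕ j ℕ.∸ toℕ i
        to-rep : ∀ a → G.Meets (rep (proj₁ (covering (F.iter a k) (F.iter-live a l)))) (F.iter a k)
        to-rep a = G.SameOrbit⇒Meets (proj₂ (covering (F.iter a k) (F.iter-live a l)))
        meets : G.Meets (F.iter (toℕ i) k) (F.iter (toℕ j) k)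
        meets = G.Meets-trans (G.Meets-sym (to-rep (toℕ i))) (subst (λ r → G.Meets (rep r) (F.iter (toℕ j) k)) (sym eq) (to-rep (toℕ j)))
        j≡ : F.iter (toℕ j) k ≡ F.iter (toℕ i) (F.iter d k)
        j≡ = trans (cong (λ c → F.iter c k) (sym (ℕₚ.m∸n+n≡m (ℕₚ.<⇒≤ i<j)))) (F.iter-+ d (toℕ i) k)

      -- Linkage makes the F-orbit of k visit every G-orbit. If d is a return, the visiting exponent
      -- can be reduced modulo d, which embeds the N orbits into `Fin d`.
      return-≥ : ∀ {d} → 0 ℕ.< d → G.Meets k (F.iter d k) → N ℕ.≤ d
      return-≥ {d@(suc _)} 0<d h = injective⇒≤ {f = position} λ {i} {j} e →
          separated i j (G.Meets⇒SameOrbit (rep-live i) (rep-live j)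
            (G.Meets-trans (G.Meets-sym (at-position i)) (subst (λ p → G.Meets (F.iter (toℕ p) k) (rep j)) (sym e) (at-position j))))
        where
        hit : ∀ i → ∃₂ λ a b → F.iter a k ≡ G.iter b (rep i)
        hit i = linked l (rep-live i)
        position : Fin N → Fin d
        position i = Fin.fromℕ< (m%n<n (proj₁ (hit i)) d)
        at-position : ∀ i → G.Meets (F.iter (toℕ (position i)) k) (rep i)
        at-position i with hit i
        ... | a , b , e = subst (λ c → G.Meets (F.iter c k) (rep i)) (sym (toℕ-fromℕ< (m%n<n a d)))
                            (G.Meets-trans (Meets-% l h a) (0 , b , e))

      N>0 : 0 ℕ.< N
      N>0 = let _ , 0<d , d≤N , _ = exists-return in ℕₚ.<-≤-trans 0<d d≤N

      return-at-N : G.Meets k (F.iter N k)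
      return-at-N = let _ , 0<d , d≤N , h = exists-return in
        subst (λ c → G.Meets k (F.iter c k)) (ℕₚ.≤-antisym d≤N (return-≥ 0<d h)) h

      return-∣ : ∀ {a} → G.Meets k (F.iter a k) → N ∣ a
      return-∣ = least-divides {P = λ a → G.Meets k (F.iter a k)} N>0
        (λ {a} h → G.Meets-trans h (G.Meets-sym (Meets-% {{ℕ.>-nonZero N>0}} l return-at-N a)))
        (λ 0<a a<N h → ℕₚ.<⇒≱ a<N (return-≥ 0<a h))

    module _ {T : ℕ} (0<T : 0 ℕ.< T) (X-T : IsPeriodOf X T) {k : ℤ} (l : X k ≡ true) {q : ℕ} (h : Periodic (F.word k) q) where

      private
        d = F.disp q k

        forward : ∀ c {v} → X v ≡ true → X (v + + (c ℕ.* d)) ≡ true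
        forward zero    {v} lv = trans (cong X (ℤₚ.+-identityʳ v)) lv
        forward (suc c) {v} lv = trans (cong X (sym (ℤₚ.+-assoc v (+ d) (+ (c ℕ.* d)))))
          (forward c (trans (cong X (sym (trans (F.iter-disp q lv) (cong (λ z → v + + z) (F-disp-const l lv h))))) (F.iter-live q lv)))

      -- A shift by d preserves live entries; if it sent a dead entry v to a live one, then T - 1 further
      -- shifts would make v + d T live, contradicting the period T.
      F-shift : IsPeriodOf X d
      F-shift v with X v in e
      ... | true  = trans (cong (λ z → X (v + + z)) (sym (ℕₚ.*-identityˡ d))) (forward 1 e)
      ... | false = ¬true⇒false λ l′ → true≢false (trans (sym (trans (sym (IsPeriodOf-* X-T d v)) (trans (cong X v≡) (forward (ℕ.pred T) l′)))) e)
        where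
        v≡ : v + + (d ℕ.* T) ≡ v + + d + + (ℕ.pred T ℕ.* d)
        v≡ = sym (trans (ℤₚ.+-assoc v (+ d) (+ (ℕ.pred T ℕ.* d)))
          (cong (λ z → v + + z) (trans (cong (ℕ._* d) (ℕₚ.suc-pred T {{ℕ.>-nonZero 0<T}})) (ℕₚ.*-comm T d))))

-- Scale and minimal period of a commuting pair

module CommutingPair {X : ℤ → Bool} (F G : Mover X)
  (F-type : ∀ {k} → X k ≡ true → Mover.type F (Mover.f G k) ≡ Mover.type F k)
  (G-type : ∀ {k} → X k ≡ true → Mover.type G (Mover.f F k) ≡ Mover.type G k)
  (linked : ∀ {u v} → X u ≡ true → X v ≡ true → ∃₂ λ a b → Mover.iter F a u ≡ Mover.iter G b v)
  where

  private
    module F = Mover F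
    module G = Mover G

  linked-sym : ∀ {u v} → X u ≡ true → X v ≡ true → ∃₂ λ b a → G.iter b u ≡ F.iter a v
  linked-sym lu lv with linked lv lu
  ... | a , b , e = b , a , sym e

  module FG = Commuting F G F-type G-type
  module GF = Commuting G F G-type F-type
  module FG-transitive = FG.Transitive linked
  module GF-transitive = GF.Transitive linked-sym

  module _ {α β : ℕ} (snakes : NumOrbits X F.f α) (cosnakes : NumOrbits X G.f β) {k : ℤ} (l : X k ≡ true) where

    private
      module CF = FG-transitive.Count cosnakes l
      module CG = GF-transitive.Count snakes l

    -- F^β k = G^m k and G^α k = F^m′ k with α ≤ m and β ≤ m′; as both maps are increasing,
    -- F^β k = G^m k ≥ G^α k = F^m′ k ≥ F^β k.
    private
      squeeze : (∃ λ m → F.iter β k ≡ G.iter m k) → (∃ λ m′ → G.iter α k ≡ F.iter m′ k) → F.iter β k ≡ G.iter α k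
      squeeze (m , e) (m′ , e′) = trans e (cong (λ c → G.iter c k) (ℕₚ.≤-antisym m≤α α≤m))
        where
        disp-β : F.disp β k ≡ G.disp m k
        disp-β = F.iter-disp⁺ β l (trans e (G.iter-disp m l))
        disp-α : G.disp α k ≡ F.disp m′ k
        disp-α = G.iter-disp⁺ α l (trans e′ (F.iter-disp m′ l))
        m>0 : 0 ℕ.< m
        m>0 = ℕₚ.n≢0⇒n>0 λ { refl → ℕₚ.<⇒≢ CF.N>0 (sym (F.iter-fixed β l e)) }
        m′>0 : 0 ℕ.< m′
        m′>0 = ℕₚ.n≢0⇒n>0 λ { refl → ℕₚ.<⇒≢ CG.N>0 (sym (G.iter-fixed α l e′)) }
        α≤m : α ℕ.≤ m
        α≤m = CG.return-≥ m>0 (β , 0 , e)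
        β≤m′ : β ℕ.≤ m′
        β≤m′ = CF.return-≥ m′>0 (α , 0 , e′)
        m≤α : m ℕ.≤ α
        m≤α = G.disp-cancel-≤ m α k (begin
          G.disp m k   ≡⟨ sym disp-β ⟩
          F.disp β k   ≤⟨ F.disp-mono β≤m′ k ⟩
          F.disp m′ k  ≡⟨ sym disp-α ⟩
          G.disp α k   ∎)
          where open ℕₚ.≤-Reasoning

    common-return : F.iter β k ≡ G.iter α k
    common-return = squeeze (FG.return β l CF.return-at-N) (GF.return α l CG.return-at-N)

    module _ {T : ℕ} (minimal : IsMinPeriod X T)
      (F-T : ∀ k → F.type (k + + T) ≡ F.type k) (G-T : ∀ k → G.type (k + + T) ≡ G.type k)
      {P Q : ℕ} (leastP : LeastPeriod (F.word k) P) (leastQ : LeastPeriod (G.word k) Q)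
      {dF dG : ℕ} (β≡ : β ≡ dF ℕ.* P) (α≡ : α ≡ dG ℕ.* Q) where

      private
        module P = LeastPeriod leastP
        module Q = LeastPeriod leastQ
        p = F.disp P k
        q = G.disp Q k

        X-T = proj₁ (proj₂ minimal)

        T∣ : ∀ {d} → IsPeriodOf X d → T ∣ d
        T∣ = least-divides {P = IsPeriodOf X} (proj₁ minimal)
          (IsPeriodOf-% {{ℕ.>-nonZero (proj₁ minimal)}} X-T)
          (λ {d} 0<d d<T → proj₂ (proj₂ minimal) d 0<d d<T)

        lT : X (k + + T) ≡ true
        lT = trans (X-T k) l

        -- Obtained by comparing displacements in a link from k to k + T; the subtraction is moved
        -- to the other side to stay in ℕ.
        combination : ∃₂ λ a b → T ℕ.+ b ℕ.* q ≡ a ℕ.* p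
        combination = combine (linked l lT)
          where
          combine : (∃₂ λ a b → F.iter a k ≡ G.iter b (k + + T)) → ∃₂ λ a b → T ℕ.+ b ℕ.* q ≡ a ℕ.* p
          combine (a , b , e) with P.divides-period {a} (λ j → trans (FG.F-word-linked {a} {b} lT e j) (F.word-T X-T F-T l j))
                                 | Q.divides-period {b} (λ j → trans (sym (G.word-T X-T G-T l (j ℕ.+ b)))
                                                          (GF.F-word-linked {b} {a} l (sym e) j))
          ... | divides a′ refl | divides b′ refl = a′ , b′ , (begin
            T ℕ.+ b′ ℕ.* q                        ≡⟨ cong (T ℕ.+_) (sym (G.disp-* Q.period b′)) ⟩
            T ℕ.+ G.disp b k                      ≡⟨ cong (T ℕ.+_) (G.disp-cong b (λ j → sym (G.word-T X-T G-T l j))) ⟩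
            T ℕ.+ G.disp b (k + + T)              ≡⟨ sym (F.iter-disp⁺ a l (trans e (trans (G.iter-disp b lT) (ℤₚ.+-assoc k (+ T) (+ G.disp b (k + + T)))))) ⟩
            F.disp a k                            ≡⟨ F.disp-* P.period a′ ⟩
            a′ ℕ.* p                              ∎)
            where open ≡-Reasoning

        Scale≡ : F.disp β k ≡ dF ℕ.* p
        Scale≡ = trans (cong (λ c → F.disp c k) β≡) (F.disp-* P.period dF)

        scales-agree : dF ℕ.* p ≡ dG ℕ.* q
        scales-agree = begin
          dF ℕ.* p            ≡⟨ sym Scale≡ ⟩
          F.disp β k          ≡⟨ F.iter-disp⁺ β l (trans common-return (G.iter-disp α l)) ⟩
          G.disp α k          ≡⟨ cong (λ c → G.disp c k) α≡ ⟩
          G.disp (dG ℕ.* Q) k ≡⟨ G.disp-* Q.period dG ⟩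
          dG ℕ.* q            ∎
          where open ≡-Reasoning

        -- Equal displacements from k mean equal endpoints, so F^(xP) k lies on the G-orbit of k,
        -- and return exponents are multiples of β.
        coincidence : ∀ x y → x ℕ.* p ≡ y ℕ.* q → dF ℕ.* P ∣ x ℕ.* P
        coincidence x y e = subst (_∣ x ℕ.* P) β≡ (CF.return-∣ (y ℕ.* Q , 0 , (begin
          G.iter (y ℕ.* Q) k            ≡⟨ G.iter-disp (y ℕ.* Q) l ⟩
          k + + G.disp (y ℕ.* Q) k      ≡⟨ cong (λ z → k + + z) (trans (G.disp-* Q.period y) (trans (sym e) (sym (F.disp-* P.period x)))) ⟩
          k + + F.disp (x ℕ.* P) k      ≡⟨ sym (F.iter-disp (x ℕ.* P) l) ⟩
          F.iter (x ℕ.* P) k            ∎)))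
          where open ≡-Reasoning

      minimal-period : T ≡ ℕ-GCD.gcd p q × T ℕ.* (dF ℕ.* dG) ≡ F.disp β k
      minimal-period = let T≡ , product = period-arithmetic {dF = dF} {dG = dG} (proj₁ minimal) (ℕₚ.<-≤-trans P.positive (F.a≤disp P k))
                             (subst (0 ℕ.<_) β≡ CF.N>0)
                             (T∣ (FG-transitive.F-shift (proj₁ minimal) X-T l P.period))
                             (T∣ (GF-transitive.F-shift (proj₁ minimal) X-T l Q.period))
                             combination scales-agree coincidence
                       in T≡ , trans product (sym Scale≡)

-- Toggling along the cycle

nor : Bool → Bool → Bool → Bool
nor a b c = not (a ∨ b ∨ c)

nor-cong : ∀ {a a′ b b′ c c′} → a ≡ a′ → b ≡ b′ → c ≡ c′ → nor a b c ≡ nor a′ b′ c′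
nor-cong refl refl refl = refl

module _ {A : Set} {R : A → A → Set} where

  AllPairs-reverse : ∀ {xs} → AllPairs R xs → AllPairs (flip R) (reverse xs)
  AllPairs-reverse AllPairs.[] = AllPairs.[]
  AllPairs-reverse {x ∷ xs} (h AllPairs.∷ hs) =
    subst (AllPairs (flip R)) (sym (unfold-reverse x xs))
      (AllPairsₚ.++⁺ (AllPairs-reverse hs) (All.[] AllPairs.∷ AllPairs.[]) (All.tabulate (λ x∈ → All.lookup h (Anyₚ.reverse⁻ x∈) All.∷ All.[])))

toℕ-mod : ∀ a n .{{_ : NonZero n}} → toℕ (a mod n) ≡ a % n
toℕ-mod a n = toℕ-fromℕ< (m%n<n a n)

mod-toℕ : ∀ {n} .{{_ : NonZero n}} (v : Fin n) → toℕ v mod n ≡ v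
mod-toℕ {n} v = toℕ-injective (trans (toℕ-mod (toℕ v) n) (m<n⇒m%n≡m (toℕ<n v)))

module Rows (m : ℕ) where

  n : ℕ
  n = suc (suc m)

  toℕ-nxt : ∀ v → (suc (toℕ v) ℕ.< n × toℕ (nxt n v) ≡ suc (toℕ v)) ⊎ (suc (toℕ v) ≡ n × toℕ (nxt n v) ≡ 0)
  toℕ-nxt v with ℕₚ.m≤n⇒m<n∨m≡n (toℕ<n v)
  ... | inj₁ lt = inj₁ (lt , trans (toℕ-mod (toℕ v ℕ.+ 1) n) (trans (cong (_% n) (ℕₚ.+-comm (toℕ v) 1)) (m<n⇒m%n≡m lt)))
  ... | inj₂ eq = inj₂ (eq , trans (toℕ-mod (toℕ v ℕ.+ 1) n)
                              (trans (cong (_% n) (trans (ℕₚ.+-comm (toℕ v) 1) eq)) (n%n≡0 n)))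

  toℕ-prv : ∀ v → (toℕ v ≡ suc (toℕ (prv n v))) ⊎ (toℕ v ≡ 0 × toℕ (prv n v) ≡ suc m)
  toℕ-prv v with toℕ v in eq
  ... | zero  = inj₂ (refl , trans (toℕ-mod (suc m) n) (m<n⇒m%n≡m ℕₚ.≤-refl))
  ... | suc t = inj₁ (cong suc (sym (begin
      toℕ ((suc t ℕ.+ suc m) mod n) ≡⟨ toℕ-mod (suc t ℕ.+ suc m) n ⟩
      (suc t ℕ.+ suc m) % n         ≡⟨ cong (_% n) (sym (ℕₚ.+-suc t (suc m))) ⟩
      (t ℕ.+ n) % n                 ≡⟨ [m+n]%n≡m%n t n ⟩
      t % n                       ≡⟨ m<n⇒m%n≡m (ℕₚ.<-trans (ℕₚ.n<1+n t) (subst (ℕ._< n) eq (toℕ<n v))) ⟩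
      t ∎)))
    where open ≡-Reasoning

  nxt-prv : ∀ v → nxt n (prv n v) ≡ v
  nxt-prv v with toℕ-prv v | toℕ-nxt (prv n v)
  ... | inj₁ e       | inj₁ (_ , e′) = toℕ-injective (trans e′ (sym e))
  ... | inj₁ e       | inj₂ (e′ , _) = contradiction (trans e e′) (ℕₚ.<⇒≢ (toℕ<n v))
  ... | inj₂ (_ , e) | inj₁ (lt , _) = contradiction (cong suc e) (ℕₚ.<⇒≢ lt)
  ... | inj₂ (z , _) | inj₂ (_ , e′) = toℕ-injective (trans e′ (sym z))

  prv-nxt : ∀ v → prv n (nxt n v) ≡ v
  prv-nxt v with toℕ-nxt v | toℕ-prv (nxt n v)
  ... | inj₁ (_ , e) | inj₁ e′      = toℕ-injective (ℕₚ.suc-injective (trans (sym e′) e))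
  ... | inj₁ (_ , e) | inj₂ (z , _) = contradiction (trans (sym e) z) λ ()
  ... | inj₂ (_ , z) | inj₁ e′      = contradiction (trans (sym e′) z) λ ()
  ... | inj₂ (e , _) | inj₂ (_ , e′) = toℕ-injective (trans e′ (ℕₚ.suc-injective (sym e)))

  nxt≢ : ∀ v → nxt n v ≢ v
  nxt≢ v h with toℕ-nxt v
  ... | inj₁ (_ , e) = ℕₚ.1+n≢n (trans (sym e) (cong toℕ h))
  ... | inj₂ (e , z) = contradiction (trans (sym e) (cong suc (trans (cong toℕ (sym h)) z))) λ ()

  prv≢ : ∀ v → prv n v ≢ v
  prv≢ v h = nxt≢ v (trans (cong (nxt n) (sym h)) (nxt-prv v))

  Ind : Config n → Set
  Ind = Independent n

  Ind-prv : ∀ {w} → Ind w → ∀ {v} → w v ≡ true → w (prv n v) ≡ false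
  Ind-prv {w} iw {v} h = ¬true⇒false λ p →
    true≢false (trans (sym h) (trans (cong w (sym (nxt-prv v))) (iw _ p)))

  setAt-same : ∀ k b w → setAt n k b w k ≡ b
  setAt-same k b w rewrite dec-true (k Fin.≟ k) refl = refl

  setAt-other : ∀ k b w {u} → u ≢ k → setAt n k b w u ≡ w u
  setAt-other k b w {u} h rewrite dec-false (u Fin.≟ k) h = refl

  private
    pairOK : Config n → Fin n → Bool
    pairOK w i = not (w i ∧ w (nxt n i))

    and-map⁺ : ∀ (p : Fin n → Bool) is → (∀ i → p i ≡ true) → BLA.and (List.map p is) ≡ true
    and-map⁺ p []       h = refl
    and-map⁺ p (i ∷ is) h rewrite h i = and-map⁺ p is h

    and-map⁻ : ∀ (p : Fin n → Bool) {is i} → BLA.and (List.map p is) ≡ true → i ∈ is → p i ≡ true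
    and-map⁻ p {j ∷ is} h i∈ with p j in eq | i∈
    ... | true | here refl = eq
    ... | true | there i∈′ = and-map⁻ p h i∈′

  isIndB⁺ : ∀ {w} → Ind w → isIndB n w ≡ true
  isIndB⁺ {w} iw = and-map⁺ (pairOK w) (allFin n) ok
    where
    ok : ∀ i → pairOK w i ≡ true
    ok i with w i in eq
    ... | false = refl
    ... | true rewrite iw i eq = refl

  isIndB⁻ : ∀ {w} → isIndB n w ≡ true → Ind w
  isIndB⁻ {w} h i wi with and-map⁻ (pairOK w) h (∈-allFin i)
  ... | p rewrite wi with w (nxt n i)
  ... | false = refl

  setAt-false-Ind : ∀ k {w} → Ind w → Ind (setAt n k false w)
  setAt-false-Ind k {w} iw i h with i Fin.≟ k | nxt n i Fin.≟ k
  ... | no _ | yes _ = refl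
  ... | no _ | no _  = iw i h

  setAt-true-Ind : ∀ k {w} → Ind w → w (prv n k) ≡ false → w (nxt n k) ≡ false → Ind (setAt n k true w)
  setAt-true-Ind k {w} iw p q i h with i Fin.≟ k | nxt n i Fin.≟ k
  ... | yes refl | yes e = contradiction e (nxt≢ i)
  ... | yes refl | no _  = q
  ... | no _ | yes refl  = contradiction (trans (sym h) (trans (cong w (sym (prv-nxt i))) p)) true≢false
  ... | no _ | no _      = iw i h

  -- The same rule is recorded in both directions, reflecting that a toggle is an involution on
  -- independent sets. The backward form governs the rows of negative index.
  record Toggled (k : Fin n) (w w′ : Config n) : Set where
    field
      ind   : Ind w′
      other : ∀ {u} → u ≢ k → w′ u ≡ w u
      fwd   : w′ k ≡ nor (w k) (w (prv n k)) (w (nxt n k))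
      bwd   : w k ≡ nor (w′ k) (w (prv n k)) (w (nxt n k))

  toggled : ∀ k {w} → Ind w → Toggled k w (toggle n k w)
  toggled k {w} iw with w k in wk
  ... | true = record
    { ind   = setAt-false-Ind k iw
    ; other = setAt-other k false w
    ; fwd   = trans (setAt-same k false w) (nor-cong (sym wk) (refl {x = w (prv n k)}) (refl {x = w (nxt n k)}))
    ; bwd   = trans wk (sym back) }
    where
    back : nor (setAt n k false w k) (w (prv n k)) (w (nxt n k)) ≡ true
    back rewrite setAt-same k false w | Ind-prv iw wk | iw k wk = refl
  ... | false with isIndB n (setAt n k true w) in eq
  ...   | true = record
    { ind   = i′
    ; other = setAt-other k true w
    ; fwd   = trans (setAt-same k true w) (sym front)
    ; bwd   = trans wk (sym back) }
    where
    i′ = isIndB⁻ eq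
    w-prv : w (prv n k) ≡ false
    w-prv = trans (sym (setAt-other k true w (prv≢ k))) (Ind-prv i′ (setAt-same k true w))
    w-nxt : w (nxt n k) ≡ false
    w-nxt = trans (sym (setAt-other k true w (nxt≢ k))) (i′ k (setAt-same k true w))
    front : nor (w k) (w (prv n k)) (w (nxt n k)) ≡ true
    front rewrite wk | w-prv | w-nxt = refl
    back : nor (setAt n k true w k) (w (prv n k)) (w (nxt n k)) ≡ false
    back rewrite setAt-same k true w = refl
  ...   | false = record { ind = iw ; other = λ _ → refl ; fwd = trans wk (sym blocked′)
                         ; bwd = trans wk (sym blocked′) }
    where
    blocked : nor false (w (prv n k)) (w (nxt n k)) ≡ false
    blocked with w (prv n k) in p | w (nxt n k) in q
    ... | true  | _     = refl
    ... | false | true  = refl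
    ... | false | false = contradiction (trans (sym (isIndB⁺ (setAt-true-Ind k iw p q))) eq) true≢false
    blocked′ : nor (w k) (w (prv n k)) (w (nxt n k)) ≡ false
    blocked′ = trans (nor-cong wk (refl {x = w (prv n k)}) (refl {x = w (nxt n k)})) blocked

  -- `mix lt y z v u` is the state of vertex u at the moment v is toggled, when the
  -- vertices are toggled in increasing lt-order starting from y and ending at z.
  mix : (Fin n → Fin n → Bool) → Config n → Config n → Fin n → Fin n → Bool
  mix lt y z v u = if lt u v then z u else y u

  -- The order is a parameter because τ sweeps upwards and its inverse downwards.
  module Sweep (lt : Fin n → Fin n → Bool)
               (irrefl : ∀ v → lt v v ≡ false)
               (asym : ∀ {u v} → lt u v ≡ true → lt v u ≡ false) where

    sweep : Config n → List (Fin n) → Config n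
    sweep = foldl (λ y k → toggle n k y)

    record Swept (ks : List (Fin n)) (w z : Config n) : Set where
      field
        ind   : Ind z
        other : ∀ {u} → All (u ≢_) ks → z u ≡ w u
        fwd   : ∀ {v} → v ∈ ks → z v ≡ nor (w v) (mix lt w z v (prv n v)) (mix lt w z v (nxt n v))
        bwd   : ∀ {v} → v ∈ ks → w v ≡ nor (z v) (mix lt w z v (prv n v)) (mix lt w z v (nxt n v))

    swept : ∀ {ks w} → AllPairs (λ a b → lt a b ≡ true) ks → Ind w → Swept ks w (sweep w ks)
    swept AllPairs.[] iw = record { ind = iw ; other = λ _ → refl ; fwd = λ () ; bwd = λ () }
    swept {k ∷ ks} {w} (k< AllPairs.∷ sorted) iw = record
      { ind = Rest.ind ; other = λ { (h All.∷ hs) → trans (Rest.other hs) (Head.other h) }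
      ; fwd = fwd ; bwd = bwd }
      where
      w₁ = toggle n k w
      z = sweep w₁ ks
      module Head = Toggled (toggled k iw)
      module Rest = Swept (swept sorted Head.ind)

      lt⇒≢ : ∀ {u v} → lt u v ≡ true → u ≢ v
      lt⇒≢ h refl = true≢false (trans (sym h) (irrefl _))

      after : ∀ {v} → v ∈ ks → ∀ u → mix lt w₁ z v u ≡ mix lt w z v u
      after {v} v∈ u with lt u v in eq
      ... | true  = refl
      ... | false = Head.other λ { refl → true≢false (trans (sym (All.lookup k< v∈)) eq) }

      w₁-after : ∀ {v} → v ∈ ks → w₁ v ≡ w v
      w₁-after v∈ = Head.other (λ e → lt⇒≢ (All.lookup k< v∈) (sym e))

      -- When k heads the list, an `lt`-earlier vertex cannot occur in the sorted tail, so it is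
      -- never toggled and its initial and final values agree.
      at : ∀ {u} → u ≢ k → w u ≡ mix lt w z k u
      at {u} u≢k with lt u k in eq
      ... | false = refl
      ... | true  = sym (trans (Rest.other (All.map (λ { h refl → true≢false (trans (sym h) (asym eq)) }) k<)) (Head.other u≢k))

      z-k : z k ≡ w₁ k
      z-k = Rest.other (All.map lt⇒≢ k<)

      fwd : ∀ {v} → v ∈ k ∷ ks → z v ≡ nor (w v) (mix lt w z v (prv n v)) (mix lt w z v (nxt n v))
      fwd (here refl) = trans z-k (trans Head.fwd (nor-cong (refl {x = w k}) (at (prv≢ k)) (at (nxt≢ k))))
      fwd {v} (there v∈) = trans (Rest.fwd v∈) (nor-cong (w₁-after v∈) (after v∈ (prv n v)) (after v∈ (nxt n v)))

      bwd : ∀ {v} → v ∈ k ∷ ks → w v ≡ nor (z v) (mix lt w z v (prv n v)) (mix lt w z v (nxt n v))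
      bwd (here refl) = trans Head.bwd (nor-cong (sym z-k) (at (prv≢ k)) (at (nxt≢ k)))
      bwd {v} (there v∈) = trans (sym (w₁-after v∈)) (trans (Rest.bwd v∈) (nor-cong (refl {x = z v}) (after v∈ (prv n v)) (after v∈ (nxt n v))))

  _≺_ : Fin n → Fin n → Bool
  u ≺ v = toℕ u ℕ.<ᵇ toℕ v

  ≺-irrefl : ∀ v → (v ≺ v) ≡ false
  ≺-irrefl v = dec-false (toℕ v ℕ.<? toℕ v) (ℕₚ.<-irrefl refl)

  ≺-true⁻ : ∀ {u v} → (u ≺ v) ≡ true → toℕ u ℕ.< toℕ v
  ≺-true⁻ {u} {v} h = ℕₚ.<ᵇ⇒< (toℕ u) (toℕ v) (subst Bool.T (sym h) _)

  ≺-asym : ∀ {u v} → (u ≺ v) ≡ true → (v ≺ u) ≡ false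
  ≺-asym {u} {v} h = dec-false (toℕ v ℕ.<? toℕ u) (ℕₚ.<-asym (≺-true⁻ {u} {v} h))

  ≺-trichotomy : ∀ {u v} → u ≢ v → (v ≺ u) ≡ not (u ≺ v)
  ≺-trichotomy {u} {v} u≢v with toℕ u ℕ.<? toℕ v
  ... | yes p = trans (dec-false (toℕ v ℕ.<? toℕ u) (ℕₚ.<-asym p)) (cong not (sym (dec-true (toℕ u ℕ.<? toℕ v) p)))
  ... | no ¬p = trans (dec-true (toℕ v ℕ.<? toℕ u) (ℕₚ.≤∧≢⇒< (ℕₚ.≮⇒≥ ¬p) (λ e → u≢v (toℕ-injective (sym e)))))
                      (cong not (sym (dec-false (toℕ u ℕ.<? toℕ v) ¬p)))

  allFin-sorted : AllPairs (λ a b → (a ≺ b) ≡ true) (allFin n)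
  allFin-sorted = AllPairsₚ.tabulate⁺-< {f = λ i → i} (λ {i} {j} → dec-true (toℕ i ℕ.<? toℕ j))

  NextRow : Config n → Config n → Set
  NextRow y z = ∀ v → z v ≡ nor (y v) (mix _≺_ y z v (prv n v)) (mix _≺_ y z v (nxt n v))

  tau-Ind : ∀ {y} → Ind y → Ind (tau n y)
  tau-Ind iy = Sweep.Swept.ind (Sweep.swept _≺_ ≺-irrefl (λ {u} {v} → ≺-asym {u} {v}) allFin-sorted iy)

  tau-NextRow : ∀ {y} → Ind y → NextRow y (tau n y)
  tau-NextRow iy v = Sweep.Swept.fwd (Sweep.swept _≺_ ≺-irrefl (λ {u} {v} → ≺-asym {u} {v}) allFin-sorted iy) (∈-allFin v)

  private
    module Down {z} (iz : Ind z) = Sweep.Swept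
      (Sweep.swept (flip _≺_) ≺-irrefl (λ {u} {v} → ≺-asym {v} {u}) (AllPairs-reverse allFin-sorted) iz)

  tauInv-Ind : ∀ {z} → Ind z → Ind (tauInv n z)
  tauInv-Ind iz = Down.ind iz

  -- The downward sweep is the upward one run backwards. For u ≠ v, the vertex u comes before v in
  -- one order exactly when it comes after v in the other, so both sweeps see the same neighbours at
  -- v, and the backward toggle rule applies.
  tauInv-NextRow : ∀ {z} → Ind z → NextRow (tauInv n z) z
  tauInv-NextRow {z} iz v = trans (Down.bwd iz (Anyₚ.reverse⁺ (∈-allFin v)))
    (nor-cong (refl {x = tauInv n z v}) (swap (prv≢ v)) (swap (nxt≢ v)))
    where
    swap : ∀ {u} → u ≢ v → mix (flip _≺_) z (tauInv n z) v u ≡ mix _≺_ (tauInv n z) z v u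
    swap {u} u≢v rewrite ≺-trichotomy u≢v with u ≺ v
    ... | true  = refl
    ... | false = refl

-- Rows, tape positions and the recurrence

quotient-mono-< : ∀ {d i j r s} → r ℕ.< d → i ℤ.< j → + r + i * + d ℤ.< + s + j * + d
quotient-mono-< {d} {i} {j} {r} {s} r<d i<j = begin-strict
  + r + i * + d   <⟨ ℤₚ.+-monoˡ-< (i * + d) (ℤ.+<+ r<d) ⟩
  + d + i * + d   ≡⟨ sym (ℤₚ.suc-* i (+ d)) ⟩
  ℤ.suc i * + d   ≤⟨ ℤₚ.*-monoʳ-≤-nonNeg (+ d) (ℤₚ.i<j⇒suc[i]≤j i<j) ⟩
  j * + d         ≤⟨ ℤₚ.i≤j+i (j * + d) (+ s) ⟩
  + s + j * + d   ∎
  where open ℤₚ.≤-Reasoning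

quotient-unique : ∀ {d i j r s} → r ℕ.< d → s ℕ.< d → + r + i * + d ≡ + s + j * + d → i ≡ j
quotient-unique {d} {i} {j} {r} {s} r<d s<d eq with ℤₚ.<-cmp i j
... | tri< i<j _ _ = contradiction eq (ℤₚ.<⇒≢ (quotient-mono-< {s = s} r<d i<j))
... | tri≈ _ i≡j _ = i≡j
... | tri> _ _ j<i = contradiction (sym eq) (ℤₚ.<⇒≢ (quotient-mono-< {s = r} s<d j<i))

module Tape (m : ℕ) (x : Config (suc (suc m))) (ind : Independent (suc (suc m)) x) where

  open Rows m

  X : ℤ → Bool
  X = tape n x

  row : ℤ → Config n
  row = orbitAt n x

  iterN-Ind : ∀ {f} → (∀ {y} → Ind y → Ind (f y)) → ∀ j → Ind (iterN n f j x)
  iterN-Ind h zero    = ind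
  iterN-Ind h (suc j) = h (iterN-Ind h j)

  row-next : ∀ i → NextRow (row i) (row (ℤ.suc i))
  row-next (+ j)          = tau-NextRow (iterN-Ind tau-Ind j)
  row-next -[1+ zero ]    = tauInv-NextRow ind
  row-next -[1+ suc j ]   = tauInv-NextRow (iterN-Ind tauInv-Ind (suc j))

  cell : ℤ → Fin n → ℤ
  cell i v = 1ℤ + (+ toℕ v + i * + n)

  tape-cell : ∀ i v → X (cell i v) ≡ row i v
  tape-cell i v = cong₂ (λ q r → row q r) quot≡ (trans (cong (_mod n) rem≡) (mod-toℕ v))
    where
    t = cell i v - 1ℤ
    decomposition : + (t %ℕ n) + (t /ℕ n) * + n ≡ + toℕ v + i * + n
    decomposition = trans (sym (a≡a%ℕn+[a/ℕn]*n t n)) (ring (+ toℕ v + i * + n))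
      where
      ring : ∀ a → (1ℤ + a) - 1ℤ ≡ a
      ring = ℤ-Solver.solve-∀
    quot≡ : t /ℕ n ≡ i
    quot≡ = quotient-unique (n%ℕd<d t n) (toℕ<n v) decomposition
    rem≡ : t %ℕ n ≡ toℕ v
    rem≡ = ℤₚ.+-injective (ℤ-cancelʳ ((t /ℕ n) * + n) _ _ (trans decomposition (cong (λ q → + toℕ v + q * + n) (sym quot≡))))

  cell-surjective : ∀ k → ∃₂ λ i v → k ≡ cell i v
  cell-surjective k = t /ℕ n , (t %ℕ n) mod n , (begin
    k                                           ≡⟨ ring k ⟩
    1ℤ + t                                      ≡⟨ cong (_+_ 1ℤ) (a≡a%ℕn+[a/ℕn]*n t n) ⟩
    1ℤ + (+ (t %ℕ n) + (t /ℕ n) * + n)          ≡⟨ cong (λ r → 1ℤ + (+ r + (t /ℕ n) * + n)) (sym toℕ-rem) ⟩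
    cell (t /ℕ n) ((t %ℕ n) mod n)              ∎)
    where
    open ≡-Reasoning
    t = k - 1ℤ
    ring : ∀ a → a ≡ 1ℤ + (a - 1ℤ)
    ring = ℤ-Solver.solve-∀
    toℕ-rem : toℕ ((t %ℕ n) mod n) ≡ t %ℕ n
    toℕ-rem = trans (toℕ-mod (t %ℕ n) n) (m<n⇒m%n≡m (n%ℕd<d t n))

  private
    module Shift (i : ℤ) (v : Fin n) where

      down : cell i v + + n ≡ cell (ℤ.suc i) v
      down = ring (+ toℕ v) i (+ n)
        where
        ring : ∀ a i n → (1ℤ + (a + i * n)) + n ≡ 1ℤ + (a + (1ℤ + i) * n)
        ring = ℤ-Solver.solve-∀

      -- Position k + 1 leaves the row exactly at the last vertex, whose right neighbour is vertex
      -- 0. That vertex is already toggled by then, so its new value in the next row is the right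
      -- one.
      right : X (cell i v + + 1) ≡ mix _≺_ (row i) (row (ℤ.suc i)) v (nxt n v)
      right with toℕ-nxt v
      ... | inj₁ (_ , e) rewrite dec-false (toℕ (nxt n v) ℕ.<? toℕ v) (subst (ℕ._≮ toℕ v) (sym e) (ℕₚ.<-asym (ℕₚ.n<1+n _))) =
        trans (cong X (trans (ring (+ toℕ v) (i * + n)) (cong (λ a → 1ℤ + (+ a + i * + n)) (sym e)))) (tape-cell i (nxt n v))
        where
        ring : ∀ a b → (1ℤ + (a + b)) + 1ℤ ≡ 1ℤ + ((1ℤ + a) + b)
        ring = ℤ-Solver.solve-∀
      ... | inj₂ (e , z) rewrite dec-true (toℕ (nxt n v) ℕ.<? toℕ v)
              (subst₂ ℕ._<_ (sym z) (sym (ℕₚ.suc-injective e)) (s≤s z≤n)) =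
        trans (cong X (begin
          cell i v + 1ℤ                          ≡⟨ ring (+ toℕ v) i (+ n) ⟩
          1ℤ + (+ suc (toℕ v) + i * + n)         ≡⟨ cong (λ a → 1ℤ + (+ a + i * + n)) e ⟩
          1ℤ + (+ n + i * + n)                   ≡⟨ ring′ i (+ n) ⟩
          1ℤ + (+ 0 + ℤ.suc i * + n)             ≡⟨ cong (λ a → 1ℤ + (+ a + ℤ.suc i * + n)) (sym z) ⟩
          cell (ℤ.suc i) (nxt n v)               ∎)) (tape-cell (ℤ.suc i) (nxt n v))
        where
        open ≡-Reasoning
        ring : ∀ a i n → (1ℤ + (a + i * n)) + 1ℤ ≡ 1ℤ + ((1ℤ + a) + i * n)
        ring = ℤ-Solver.solve-∀
        ring′ : ∀ i n → 1ℤ + (n + i * n) ≡ 1ℤ + (+ 0 + (1ℤ + i) * n)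
        ring′ = ℤ-Solver.solve-∀

      -- The mirror case: k + n - 1 is the left neighbour in the next row, already toggled, except
      -- at vertex 0. There it is the last vertex of the current row, not yet toggled.
      left : X (cell i v + + suc m) ≡ mix _≺_ (row i) (row (ℤ.suc i)) v (prv n v)
      left with toℕ-prv v
      ... | inj₁ e rewrite dec-true (toℕ (prv n v) ℕ.<? toℕ v) (ℕₚ.≤-reflexive (sym e)) =
        trans (cong X (begin
          cell i v + + suc m                               ≡⟨ cong (λ a → (1ℤ + (+ a + i * + n)) + + suc m) e ⟩
          (1ℤ + ((1ℤ + + toℕ (prv n v)) + i * + n)) + + suc m ≡⟨ ring (+ toℕ (prv n v)) i (+ suc m) ⟩
          cell (ℤ.suc i) (prv n v)                         ∎)) (tape-cell (ℤ.suc i) (prv n v))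
        where
        open ≡-Reasoning
        ring : ∀ a i n → (1ℤ + ((1ℤ + a) + i * (1ℤ + n))) + n ≡ 1ℤ + (a + (1ℤ + i) * (1ℤ + n))
        ring = ℤ-Solver.solve-∀
      ... | inj₂ (z , e) rewrite dec-false (toℕ (prv n v) ℕ.<? toℕ v) (subst (toℕ (prv n v) ℕ.≮_) (sym z) λ ()) =
        trans (cong X (begin
          cell i v + + suc m                  ≡⟨ cong (λ a → (1ℤ + (+ a + i * + n)) + + suc m) z ⟩
          (1ℤ + (+ 0 + i * + n)) + + suc m    ≡⟨ ring (i * + n) (+ suc m) ⟩
          1ℤ + (+ suc m + i * + n)            ≡⟨ cong (λ a → 1ℤ + (+ a + i * + n)) (sym e) ⟩
          cell i (prv n v)                    ∎)) (tape-cell i (prv n v))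
        where
        open ≡-Reasoning
        ring : ∀ a n → (1ℤ + (+ 0 + a)) + n ≡ 1ℤ + (n + a)
        ring = ℤ-Solver.solve-∀

  recurrence : ∀ k → X (k + + n) ≡ nor (X k) (X (k + + suc m)) (X (k + + 1))
  recurrence k with cell-surjective k
  ... | i , v , refl = trans (trans (cong X down) (tape-cell (ℤ.suc i) v))
                        (trans (row-next i v) (sym (nor-cong (tape-cell i v) left right)))
    where open Shift i v

-- Snakes and co-snakes

module Dynamics (m : ℕ) (X : ℤ → Bool)
  (recurrence : ∀ k → X (k + + (2 ℕ.+ m)) ≡ nor (X k) (X (k + + (1 ℕ.+ m))) (X (k + + 1)))
  (s c : ℤ → ℤ) (σ : ℤ → SnakeStep) (γ : ℤ → CoStep)
  (s-def : ∀ k → s k ≡ (if X (k + + 2) then k + + 2 else k + + (2 ℕ.+ m ℕ.+ 1)))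
  (σ-def : ∀ k → σ k ≡ (if X (k + + 2) then E else D))
  (c-def : ∀ k → c k ≡ (if X (k + + (2 ℕ.* (2 ℕ.+ m) ℕ.∸ 1)) then k + + (2 ℕ.* (2 ℕ.+ m) ℕ.∸ 1)
                        else k + + (2 ℕ.* (2 ℕ.+ m) ℕ.∸ 2)))
  (γ-def : ∀ k → γ k ≡ (if X (k + + (2 ℕ.* (2 ℕ.+ m) ℕ.∸ 1)) then S else L))
  where

  private
    n = 2 ℕ.+ m

  Live Dead : ℤ → Set
  Live k = X k ≡ true
  Dead k = X k ≡ false

  live-dead : ∀ {k} → Live k → Dead k → ⊥
  live-dead l d = true≢false (trans (sym l) d)

  -- A live k is an argument in three instances of the recurrence, those that produce k + 1, k + n -
  -- 1 and k + n; each therefore yields a dead entry. Here k is the middle argument of the instance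
  -- based at k - (n - 1).
  dead-right : ∀ {k} → Live k → Dead (k + + 1)
  dead-right {k} l = begin
    X (k + + 1)                                     ≡⟨ cong X (ring k (+ suc m)) ⟩
    X (k₀ + + n)                                    ≡⟨ recurrence k₀ ⟩
    nor (X k₀) (X (k₀ + + suc m)) (X (k₀ + + 1))    ≡⟨ nor-cong (refl {x = X k₀}) (trans (cong X (ring′ k (+ suc m))) l) (refl {x = X (k₀ + + 1)}) ⟩
    nor (X k₀) true (X (k₀ + + 1))                  ≡⟨ nor-true₂ (X k₀) (X (k₀ + + 1)) ⟩
    false                                           ∎
    where
    open ≡-Reasoning
    k₀ = k - + suc m
    ring : ∀ k a → k + 1ℤ ≡ (k - a) + (1ℤ + a)
    ring = ℤ-Solver.solve-∀
    ring′ : ∀ k a → (k - a) + a ≡ k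
    ring′ = ℤ-Solver.solve-∀
    nor-true₂ : ∀ a b → nor a true b ≡ false
    nor-true₂ true  _ = refl
    nor-true₂ false _ = refl

  dead-below-left : ∀ {k} → Live k → Dead (k + + suc m)
  dead-below-left {k} l = begin
    X (k + + suc m)                                 ≡⟨ cong X (ring k (+ suc m)) ⟩
    X (k₀ + + n)                                    ≡⟨ recurrence k₀ ⟩
    nor (X k₀) (X (k₀ + + suc m)) (X (k₀ + + 1))    ≡⟨ nor-cong (refl {x = X k₀}) (refl {x = X (k₀ + + suc m)}) (trans (cong X (ring′ k)) l) ⟩
    nor (X k₀) (X (k₀ + + suc m)) true              ≡⟨ nor-true₃ (X k₀) (X (k₀ + + suc m)) ⟩
    false                                           ∎
    where
    open ≡-Reasoning
    k₀ = k - 1ℤ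
    ring : ∀ k a → k + a ≡ (k - 1ℤ) + (1ℤ + a)
    ring = ℤ-Solver.solve-∀
    ring′ : ∀ k → (k - 1ℤ) + 1ℤ ≡ k
    ring′ = ℤ-Solver.solve-∀
    nor-true₃ : ∀ a b → nor a b true ≡ false
    nor-true₃ true  _     = refl
    nor-true₃ false true  = refl
    nor-true₃ false false = refl

  dead-below : ∀ {k} → Live k → Dead (k + + n)
  dead-below {k} l = trans (recurrence k) (nor-cong l (refl {x = X (k + + suc m)}) (refl {x = X (k + + 1)}))

  born : ∀ {k} → Dead k → Dead (k + + 1) → Dead (k + + suc m) → Live (k + + n)
  born {k} d d₁ d₂ = trans (recurrence k) (nor-cong d d₂ d₁)

  -- The names ending in ↓ restate the local rules at offsets from a fixed k, with the offset
  -- arithmetic as equational hypotheses to be discharged by the ring solver.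
  module From (k : ℤ) where

    shift : ∀ a c {b} → b ≡ a ℕ.+ c → (k + + a) + + c ≡ k + + b
    shift a c e = trans (ℤₚ.+-assoc k (+ a) (+ c)) (cong (λ z → k + + z) (sym e))

    X-shift : ∀ a c {b} → b ≡ a ℕ.+ c → X ((k + + a) + + c) ≡ X (k + + b)
    X-shift a c e = cong X (shift a c e)

    right↓ : ∀ a b → b ≡ a ℕ.+ 1 → Live (k + + a) → Dead (k + + b)
    right↓ a b e l = trans (sym (X-shift a 1 e)) (dead-right l)

    below-left↓ : ∀ a b → b ≡ a ℕ.+ (1 ℕ.+ m) → Live (k + + a) → Dead (k + + b)
    below-left↓ a b e l = trans (sym (X-shift a (1 ℕ.+ m) e)) (dead-below-left l)

    below↓ : ∀ a b → b ≡ a ℕ.+ (2 ℕ.+ m) → Live (k + + a) → Dead (k + + b)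
    below↓ a b e l = trans (sym (X-shift a (2 ℕ.+ m) e)) (dead-below l)

    born↓ : ∀ a {b c d} → b ≡ a ℕ.+ 1 → c ≡ a ℕ.+ (1 ℕ.+ m) → d ≡ a ℕ.+ (2 ℕ.+ m) →
            Dead (k + + a) → Dead (k + + b) → Dead (k + + c) → Live (k + + d)
    born↓ a eb ec ed da db dc = trans (sym (X-shift a (2 ℕ.+ m) ed))
      (born da (trans (X-shift a 1 eb) db) (trans (X-shift a (1 ℕ.+ m) ec) dc))

  data SuccView (k : ℤ) : Set where
    E : Live (k + + 2) → s k ≡ k + + 2 → σ k ≡ E → SuccView k
    D : Dead (k + + 2) → Live (k + + (3 ℕ.+ m)) → s k ≡ k + + (3 ℕ.+ m) → σ k ≡ D → SuccView k

  data CosuccView (k : ℤ) : Set where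
    S : Live (k + + (3 ℕ.+ (m ℕ.+ m))) → c k ≡ k + + (3 ℕ.+ (m ℕ.+ m)) → γ k ≡ S → CosuccView k
    L : Dead (k + + (3 ℕ.+ (m ℕ.+ m))) → Live (k + + (2 ℕ.+ (m ℕ.+ m))) → c k ≡ k + + (2 ℕ.+ (m ℕ.+ m)) → γ k ≡ L → CosuccView k

  σ-E : ∀ {k} → Live (k + + 2) → σ k ≡ E
  σ-E {k} l = trans (σ-def k) (cong (if_then E else D) l)

  σ-D : ∀ {k} → Dead (k + + 2) → σ k ≡ D
  σ-D {k} d = trans (σ-def k) (cong (if_then E else D) d)

  2n∸2 : 2 ℕ.* n ℕ.∸ 2 ≡ 2 ℕ.+ (m ℕ.+ m)
  2n∸2 = ring m
    where
    ring : ∀ m → m ℕ.+ suc (suc (m ℕ.+ 0)) ≡ 2 ℕ.+ (m ℕ.+ m)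
    ring = ℕ-Solver.solve-∀

  c-if : ∀ k → c k ≡ (if X (k + + (3 ℕ.+ (m ℕ.+ m))) then k + + (3 ℕ.+ (m ℕ.+ m)) else k + + (2 ℕ.+ (m ℕ.+ m)))
  c-if k = subst (λ a → c k ≡ (if X (k + + suc a) then k + + suc a else k + + a)) 2n∸2 (c-def k)

  γ-if : ∀ k → γ k ≡ (if X (k + + (3 ℕ.+ (m ℕ.+ m))) then S else L)
  γ-if k = subst (λ a → γ k ≡ (if X (k + + suc a) then S else L)) 2n∸2 (γ-def k)

  γ-S : ∀ {k} → Live (k + + (3 ℕ.+ (m ℕ.+ m))) → γ k ≡ S
  γ-S {k} l = trans (γ-if k) (cong (if_then S else L) l)

  γ-L : ∀ {k} → Dead (k + + (3 ℕ.+ (m ℕ.+ m))) → γ k ≡ L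
  γ-L {k} d = trans (γ-if k) (cong (if_then S else L) d)

  -- The instance based at k + 1 has arguments k + 1 and k + n, both dead beside a live k, and k +
  -- 2. If that is dead too, k + n + 1 is live.
  succView : ∀ {k} → Live k → SuccView k
  succView {k} l with X (k + + 2) in eq
  ... | true  = E eq (trans (s-def k) (cong (if_then _ else _) eq)) (σ-E eq)
  ... | false = D eq (born↓ 1 refl refl refl (dead-right l) eq (dead-below l))
      (trans (s-def k) (trans (cong (if_then _ else _) eq) (cong (λ a → k + + suc (suc a)) (ℕₚ.+-comm m 1)))) (σ-D eq)
    where open From k

  -- The instance based at k + n - 1 has arguments k + n - 1 and k + n, both dead, and k + 2n - 2.
  -- So k + 2n - 2 and k + 2n - 1 cannot both be dead.
  cosuccView : ∀ {k} → Live k → CosuccView k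
  cosuccView {k} l with X (k + + (3 ℕ.+ (m ℕ.+ m))) in eq
  ... | true  = S eq (trans (c-if k) (cong (if_then _ else _) eq)) (γ-S eq)
  ... | false = L eq live (trans (c-if k) (cong (if_then _ else _) eq)) (γ-L eq)
    where
    open From k
    live : Live (k + + (2 ℕ.+ (m ℕ.+ m)))
    live with X (k + + (2 ℕ.+ (m ℕ.+ m))) in eq′
    ... | true  = refl
    ... | false = contradiction eq (live-dead
      (born↓ (1 ℕ.+ m) {2 ℕ.+ m} {2 ℕ.+ (m ℕ.+ m)} {3 ℕ.+ (m ℕ.+ m)} (ℕ-Solver.solve (m ∷ [])) (ℕ-Solver.solve (m ∷ [])) (ℕ-Solver.solve (m ∷ []))
        (dead-below-left l) (dead-below l) eq′))

  module _ {k : ℤ} where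
    open From k

    succ-live↓ : ∀ a {b d} → b ≡ a ℕ.+ 2 → d ≡ a ℕ.+ (3 ℕ.+ m) → Live (k + + a) → Dead (k + + b) → Live (k + + d)
    succ-live↓ a eb ed l dead with succView l
    ... | E l₂ _ _    = contradiction (trans (sym (X-shift a 2 eb)) l₂) λ l → live-dead l dead
    ... | D _ l₃ _ _  = trans (sym (X-shift a (3 ℕ.+ m) ed)) l₃

    cosucc-live↓ : ∀ a {b d} → b ≡ a ℕ.+ (2 ℕ.+ (m ℕ.+ m)) → d ≡ a ℕ.+ (3 ℕ.+ (m ℕ.+ m)) →
                   Live (k + + a) → Dead (k + + b) → Live (k + + d)
    cosucc-live↓ a eb ed l dead with cosuccView l
    ... | S l₃ _ _    = trans (sym (X-shift a (3 ℕ.+ (m ℕ.+ m)) ed)) l₃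
    ... | L _ l₂ _ _  = contradiction (trans (sym (X-shift a (2 ℕ.+ (m ℕ.+ m)) eb)) l₂) λ l → live-dead l dead

    private
      σ-at : ∀ {a b v} → c k ≡ k + + a → b ≡ a ℕ.+ 2 → X (k + + b) ≡ v → X (c k + + 2) ≡ v
      σ-at {a} e e′ h = trans (cong (λ z → X (z + + 2)) e) (trans (X-shift a 2 e′) h)

      γ-at : ∀ {a b v} → s k ≡ k + + a → b ≡ a ℕ.+ (3 ℕ.+ (m ℕ.+ m)) → X (k + + b) ≡ v → X (s k + + (3 ℕ.+ (m ℕ.+ m))) ≡ v
      γ-at {a} e e′ h = trans (cong (λ z → X (z + + (3 ℕ.+ (m ℕ.+ m)))) e) (trans (X-shift a (3 ℕ.+ (m ℕ.+ m)) e′) h)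

    -- The two types are read at c k + 2 and s k + 2n - 1. These positions are k + 2n + 1 twice for
    -- E, S; k + 2n and k + 2n + 1 for E, L; k + 2n + 1 and k + 3n for D, S; k + 2n and k + 3n for
    -- D, L. In each case the local rules decide both.
    types-commute : Live k → σ (c k) ≡ σ k × γ (s k) ≡ γ k
    types-commute l with succView l | cosuccView l
    ... | E l₂ es t | S lS ec u = trans (σ-E (σ-at ec c-offset l₅)) (sym t) , trans (γ-S (γ-at es refl l₅)) (sym u)
      where
      c-offset : 5 ℕ.+ (m ℕ.+ m) ≡ 3 ℕ.+ (m ℕ.+ m) ℕ.+ 2
      c-offset = ℕ-Solver.solve (m ∷ [])
      l₅ : Live (k + + (5 ℕ.+ (m ℕ.+ m)))
      l₅ = cosucc-live↓ 2 {4 ℕ.+ (m ℕ.+ m)} {5 ℕ.+ (m ℕ.+ m)} refl refl l₂ (right↓ (3 ℕ.+ (m ℕ.+ m)) (4 ℕ.+ (m ℕ.+ m)) (ℕ-Solver.solve (m ∷ [])) lS)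
    ... | E l₂ es t | L dS lL ec u = trans (σ-E (σ-at ec c-offset l₄)) (sym t) , trans (γ-L (γ-at es refl d₅)) (sym u)
      where
      c-offset : 4 ℕ.+ (m ℕ.+ m) ≡ 2 ℕ.+ (m ℕ.+ m) ℕ.+ 2
      c-offset = ℕ-Solver.solve (m ∷ [])
      l₄ : Live (k + + (4 ℕ.+ (m ℕ.+ m)))
      l₄ = born↓ (2 ℕ.+ m) {3 ℕ.+ m} {3 ℕ.+ (m ℕ.+ m)} {4 ℕ.+ (m ℕ.+ m)} (ℕ-Solver.solve (m ∷ [])) (ℕ-Solver.solve (m ∷ [])) (ℕ-Solver.solve (m ∷ []))
             (dead-below l) (below-left↓ 2 (3 ℕ.+ m) refl l₂) dS
      d₅ : Dead (k + + (5 ℕ.+ (m ℕ.+ m)))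
      d₅ = right↓ (4 ℕ.+ (m ℕ.+ m)) (5 ℕ.+ (m ℕ.+ m)) (ℕ-Solver.solve (m ∷ [])) l₄
    ... | D d₂ l₃ es t | S lS ec u = trans (σ-D (σ-at ec c-offset d₅)) (sym t) , trans (γ-S (γ-at es s-offset l₆)) (sym u)
      where
      c-offset : 5 ℕ.+ (m ℕ.+ m) ≡ 3 ℕ.+ (m ℕ.+ m) ℕ.+ 2
      c-offset = ℕ-Solver.solve (m ∷ [])
      s-offset : 6 ℕ.+ (m ℕ.+ m ℕ.+ m) ≡ 3 ℕ.+ m ℕ.+ (3 ℕ.+ (m ℕ.+ m))
      s-offset = ℕ-Solver.solve (m ∷ [])
      d₅ : Dead (k + + (5 ℕ.+ (m ℕ.+ m)))
      d₅ = below↓ (3 ℕ.+ m) (5 ℕ.+ (m ℕ.+ m)) (ℕ-Solver.solve (m ∷ [])) l₃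
      l₆ : Live (k + + (6 ℕ.+ (m ℕ.+ m ℕ.+ m)))
      l₆ = succ-live↓ (3 ℕ.+ (m ℕ.+ m)) {5 ℕ.+ (m ℕ.+ m)} {6 ℕ.+ (m ℕ.+ m ℕ.+ m)} c-offset (ℕ-Solver.solve (m ∷ [])) lS d₅
    ... | D d₂ l₃ es t | L dS lL ec u = trans (σ-D (σ-at ec c-offset d₄)) (sym t) , trans (γ-L (γ-at es s-offset d₆)) (sym u)
      where
      c-offset : 4 ℕ.+ (m ℕ.+ m) ≡ 2 ℕ.+ (m ℕ.+ m) ℕ.+ 2
      c-offset = ℕ-Solver.solve (m ∷ [])
      s-offset : 6 ℕ.+ (m ℕ.+ m ℕ.+ m) ≡ 3 ℕ.+ m ℕ.+ (3 ℕ.+ (m ℕ.+ m))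
      s-offset = ℕ-Solver.solve (m ∷ [])
      d₄ : Dead (k + + (4 ℕ.+ (m ℕ.+ m)))
      d₄ = below-left↓ (3 ℕ.+ m) (4 ℕ.+ (m ℕ.+ m)) (ℕ-Solver.solve (m ∷ [])) l₃
      d₆ : Dead (k + + (6 ℕ.+ (m ℕ.+ m ℕ.+ m)))
      d₆ = right↓ (5 ℕ.+ (m ℕ.+ m ℕ.+ m)) (6 ℕ.+ (m ℕ.+ m ℕ.+ m)) (ℕ-Solver.solve (m ∷ []))
             (succ-live↓ (2 ℕ.+ (m ℕ.+ m)) {4 ℕ.+ (m ℕ.+ m)} {5 ℕ.+ (m ℕ.+ m ℕ.+ m)} c-offset (ℕ-Solver.solve (m ∷ [])) lL d₄)

  s-live : ∀ {k} → Live k → Live (s k)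
  s-live l with succView l
  ... | E l′ e _   = trans (cong X e) l′
  ... | D _ l′ e _ = trans (cong X e) l′

  c-live : ∀ {k} → Live k → Live (c k)
  c-live l with cosuccView l
  ... | S l′ e _   = trans (cong X e) l′
  ... | L _ l′ e _ = trans (cong X e) l′

  private
    -- Steps of different type with a common target would start at distance n - 1 for s, and at
    -- distance 1 for c; live entries never lie at these distances.
    s-no-merge : ∀ {u v} → Live v → u + + 2 ≡ v + + (3 ℕ.+ m) → Dead u
    s-no-merge {u} {v} l e = trans (cong X (ℤ-cancelʳ (+ 2) u (v + + (1 ℕ.+ m)) (trans e (ring v (+ m))))) (dead-below-left l)
      where
      ring : ∀ v m → v + (+ 3 + m) ≡ (v + (+ 1 + m)) + + 2
      ring = ℤ-Solver.solve-∀

    c-no-merge : ∀ {u v} → Live u → u + + (3 ℕ.+ (m ℕ.+ m)) ≡ v + + (2 ℕ.+ (m ℕ.+ m)) → Dead v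
    c-no-merge {u} {v} l e = trans (cong X (sym (ℤ-cancelʳ (+ (2 ℕ.+ (m ℕ.+ m))) (u + + 1) v (trans (ring u (+ (m ℕ.+ m))) e)))) (dead-right l)
      where
      ring : ∀ u a → (u + + 1) + (+ 2 + a) ≡ u + (+ 3 + a)
      ring = ℤ-Solver.solve-∀

  s-injective : ∀ {u v} → Live u → Live v → s u ≡ s v → u ≡ v
  s-injective {u} {v} lu lv e with succView lu | succView lv
  ... | E _ eu _   | E _ ev _   = ℤ-cancelʳ (+ 2) u v (trans (sym eu) (trans e ev))
  ... | D _ _ eu _ | D _ _ ev _ = ℤ-cancelʳ (+ (3 ℕ.+ m)) u v (trans (sym eu) (trans e ev))
  ... | E _ eu _   | D _ _ ev _ = contradiction (s-no-merge lv (trans (sym eu) (trans e ev))) (live-dead lu)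
  ... | D _ _ eu _ | E _ ev _   = contradiction (s-no-merge lu (trans (sym ev) (trans (sym e) eu))) (live-dead lv)

  c-injective : ∀ {u v} → Live u → Live v → c u ≡ c v → u ≡ v
  c-injective {u} {v} lu lv e with cosuccView lu | cosuccView lv
  ... | S _ eu _   | S _ ev _   = ℤ-cancelʳ (+ (3 ℕ.+ (m ℕ.+ m))) u v (trans (sym eu) (trans e ev))
  ... | L _ _ eu _ | L _ _ ev _ = ℤ-cancelʳ (+ (2 ℕ.+ (m ℕ.+ m))) u v (trans (sym eu) (trans e ev))
  ... | S _ eu _   | L _ _ ev _ = contradiction (c-no-merge lu (trans (sym eu) (trans e ev))) (live-dead lv)
  ... | L _ _ eu _ | S _ ev _   = contradiction (c-no-merge lv (trans (sym ev) (trans (sym e) eu))) (live-dead lu)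

  module _ {k : ℤ} where
    open From k

    private
      s-D↓ : ∀ a b d → b ≡ a ℕ.+ 2 → d ≡ a ℕ.+ (3 ℕ.+ m) → Live (k + + a) → Dead (k + + b) → s (k + + a) ≡ k + + d
      s-D↓ a b d eb ed l dead with succView l
      ... | E l₂ _ _   = contradiction (trans (sym (X-shift a 2 eb)) l₂) λ l → live-dead l dead
      ... | D _ _ e _  = trans e (shift a (3 ℕ.+ m) ed)

      s-E↓ : ∀ a b → b ≡ a ℕ.+ 2 → Live (k + + a) → Live (k + + b) → s (k + + a) ≡ k + + b
      s-E↓ a b eb l l′ with succView l
      ... | E _ e _    = trans e (shift a 2 eb)
      ... | D d _ _ _  = contradiction (trans (sym (X-shift a 2 eb)) d) (live-dead l′)

      c-S↓ : ∀ a b → b ≡ a ℕ.+ (3 ℕ.+ (m ℕ.+ m)) → Live (k + + a) → Live (k + + b) → c (k + + a) ≡ k + + b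
      c-S↓ a b eb l l′ with cosuccView l
      ... | S _ e _    = trans e (shift a (3 ℕ.+ (m ℕ.+ m)) eb)
      ... | L d _ _ _  = contradiction (trans (sym (X-shift a (3 ℕ.+ (m ℕ.+ m)) eb)) d) (live-dead l′)

      c-L↓ : ∀ a b d → b ≡ a ℕ.+ (3 ℕ.+ (m ℕ.+ m)) → d ≡ a ℕ.+ (2 ℕ.+ (m ℕ.+ m)) →
             Live (k + + a) → Dead (k + + b) → c (k + + a) ≡ k + + d
      c-L↓ a b d eb ed l dead with cosuccView l
      ... | S l₃ _ _   = contradiction (trans (sym (X-shift a (3 ℕ.+ (m ℕ.+ m)) eb)) l₃) λ l → live-dead l dead
      ... | L _ _ e _  = trans e (shift a (2 ℕ.+ (m ℕ.+ m)) ed)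

    -- If k + g is the next live entry after k and g ≥ 3, then the snake of k goes down, runs
    -- along the row below the gap, and goes down again, ending at the co-successor of k + g.
    scan : ∀ r j → Live (k + + (3 ℕ.+ m ℕ.+ (j ℕ.+ j))) → iterℤ s (suc j) k ≡ k + + (3 ℕ.+ m ℕ.+ (j ℕ.+ j)) →
           Live (k + + (3 ℕ.+ (j ℕ.+ j) ℕ.+ r)) → LinkedBetween X s c k (3 ℕ.+ (j ℕ.+ j) ℕ.+ r)
    scan r j below below-eq target with X (k + + (3 ℕ.+ (j ℕ.+ j))) in eq₃
    -- Odd gap 3 + 2j: the entry below k + 3 + 2j is dead, which forces the snake down to k + 2n + 2
    -- + 2j, a co-step of type S away.
    ... | true = linkedBetween refl eq₃ (suc (suc j) , 1 ,
        trans (iterℤ-snoc s (suc j) k) (trans (cong s below-eq) (trans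
          (s-D↓ (3 ℕ.+ m ℕ.+ (j ℕ.+ j)) (5 ℕ.+ m ℕ.+ (j ℕ.+ j)) (6 ℕ.+ (m ℕ.+ m) ℕ.+ (j ℕ.+ j)) eqA eqB below d₅)
          (sym (c-S↓ (3 ℕ.+ (j ℕ.+ j)) (6 ℕ.+ (m ℕ.+ m) ℕ.+ (j ℕ.+ j)) (ℕ-Solver.solve (m ∷ j ∷ [])) eq₃ l₆)))))
      where
      eqA : 5 ℕ.+ m ℕ.+ (j ℕ.+ j) ≡ 3 ℕ.+ m ℕ.+ (j ℕ.+ j) ℕ.+ 2
      eqA = ℕ-Solver.solve (m ∷ j ∷ [])
      eqB : 6 ℕ.+ (m ℕ.+ m) ℕ.+ (j ℕ.+ j) ≡ 3 ℕ.+ m ℕ.+ (j ℕ.+ j) ℕ.+ (3 ℕ.+ m)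
      eqB = ℕ-Solver.solve (m ∷ j ∷ [])
      d₅ : Dead (k + + (5 ℕ.+ m ℕ.+ (j ℕ.+ j)))
      d₅ = below↓ (3 ℕ.+ (j ℕ.+ j)) (5 ℕ.+ m ℕ.+ (j ℕ.+ j)) (ℕ-Solver.solve (m ∷ j ∷ [])) eq₃
      l₆ : Live (k + + (6 ℕ.+ (m ℕ.+ m) ℕ.+ (j ℕ.+ j)))
      l₆ = succ-live↓ {k} (3 ℕ.+ m ℕ.+ (j ℕ.+ j)) {5 ℕ.+ m ℕ.+ (j ℕ.+ j)} {6 ℕ.+ (m ℕ.+ m) ℕ.+ (j ℕ.+ j)} eqA eqB below d₅
    scan zero j below below-eq target | false =
      contradiction eq₃ (live-dead (trans (cong (λ a → X (k + + a)) (sym (ℕₚ.+-identityʳ (3 ℕ.+ (j ℕ.+ j))))) target))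
    scan (suc r) j below below-eq target | false with X (k + + (4 ℕ.+ (j ℕ.+ j))) in eq₄
    -- Even gap 4 + 2j: the snake is forced down to the same position, which is now a co-step of
    -- type L away because its right neighbour is dead.
    ... | true = linkedBetween {r = r} (cong (3 ℕ.+_) (ℕₚ.+-suc (j ℕ.+ j) r)) eq₄ (suc (suc j) , 1 ,
        trans (iterℤ-snoc s (suc j) k) (trans (cong s below-eq) (trans
          (s-D↓ (3 ℕ.+ m ℕ.+ (j ℕ.+ j)) (5 ℕ.+ m ℕ.+ (j ℕ.+ j)) (6 ℕ.+ (m ℕ.+ m) ℕ.+ (j ℕ.+ j)) eqA eqB below d₅)
          (sym (c-L↓ (4 ℕ.+ (j ℕ.+ j)) (7 ℕ.+ (m ℕ.+ m) ℕ.+ (j ℕ.+ j)) (6 ℕ.+ (m ℕ.+ m) ℕ.+ (j ℕ.+ j))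
                 (ℕ-Solver.solve (m ∷ j ∷ [])) (ℕ-Solver.solve (m ∷ j ∷ [])) eq₄ d₇)))))
      where
      eqA : 5 ℕ.+ m ℕ.+ (j ℕ.+ j) ≡ 3 ℕ.+ m ℕ.+ (j ℕ.+ j) ℕ.+ 2
      eqA = ℕ-Solver.solve (m ∷ j ∷ [])
      eqB : 6 ℕ.+ (m ℕ.+ m) ℕ.+ (j ℕ.+ j) ≡ 3 ℕ.+ m ℕ.+ (j ℕ.+ j) ℕ.+ (3 ℕ.+ m)
      eqB = ℕ-Solver.solve (m ∷ j ∷ [])
      d₅ : Dead (k + + (5 ℕ.+ m ℕ.+ (j ℕ.+ j)))
      d₅ = below-left↓ (4 ℕ.+ (j ℕ.+ j)) (5 ℕ.+ m ℕ.+ (j ℕ.+ j)) (ℕ-Solver.solve (m ∷ j ∷ [])) eq₄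
      d₇ : Dead (k + + (7 ℕ.+ (m ℕ.+ m) ℕ.+ (j ℕ.+ j)))
      d₇ = right↓ (6 ℕ.+ (m ℕ.+ m) ℕ.+ (j ℕ.+ j)) (7 ℕ.+ (m ℕ.+ m) ℕ.+ (j ℕ.+ j)) (ℕ-Solver.solve (m ∷ j ∷ []))
             (succ-live↓ {k} (3 ℕ.+ m ℕ.+ (j ℕ.+ j)) {5 ℕ.+ m ℕ.+ (j ℕ.+ j)} {6 ℕ.+ (m ℕ.+ m) ℕ.+ (j ℕ.+ j)} eqA eqB below d₅)
    scan (suc zero) j below below-eq target | false | false =
      contradiction eq₄ (live-dead (trans (cong (λ a → X (k + + (3 ℕ.+ a))) (ℕₚ.+-comm 1 (j ℕ.+ j))) target))
    -- Two more dead entries above, together with the dead right neighbour of the snake's head, give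
    -- birth two places to the right of the head, so the snake takes an E step.
    scan (suc (suc r)) j below below-eq target | false | false =
      subst (LinkedBetween X s c k) (sym eqT) (scan r (suc j) l₅
        (trans (iterℤ-snoc s (suc j) k) (trans (cong s below-eq)
          (s-E↓ (3 ℕ.+ m ℕ.+ (j ℕ.+ j)) (3 ℕ.+ m ℕ.+ (suc j ℕ.+ suc j)) (ℕ-Solver.solve (m ∷ j ∷ [])) below l₅)))
        (subst (λ a → Live (k + + a)) eqT target))
      where
      eqT : 3 ℕ.+ (j ℕ.+ j) ℕ.+ (2 ℕ.+ r) ≡ 3 ℕ.+ (suc j ℕ.+ suc j) ℕ.+ r
      eqT = ℕ-Solver.solve (j ∷ r ∷ [])
      l₅ : Live (k + + (3 ℕ.+ m ℕ.+ (suc j ℕ.+ suc j)))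
      l₅ = born↓ (3 ℕ.+ (j ℕ.+ j)) {4 ℕ.+ (j ℕ.+ j)} {4 ℕ.+ m ℕ.+ (j ℕ.+ j)} {3 ℕ.+ m ℕ.+ (suc j ℕ.+ suc j)}
             (ℕ-Solver.solve (j ∷ [])) (ℕ-Solver.solve (m ∷ j ∷ [])) (ℕ-Solver.solve (m ∷ j ∷ [])) eq₃ eq₄
             (right↓ (3 ℕ.+ m ℕ.+ (j ℕ.+ j)) (4 ℕ.+ m ℕ.+ (j ℕ.+ j)) (ℕ-Solver.solve (m ∷ j ∷ [])) below)

    next-linked : ∀ d → Live k → Live (k + + suc d) → LinkedBetween X s c k (suc d)
    next-linked zero          l target = contradiction (dead-right l) (live-dead target)
    next-linked (suc d)       l target with succView l
    next-linked (suc d)       l target | E l₂ e _ = linkedBetween {r = d} refl l₂ (1 , 0 , e)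
    next-linked (suc zero)    l target | D d₂ _ _ _ = contradiction d₂ (live-dead target)
    next-linked (suc (suc d)) l target | D _ l₃ e _ =
      scan d 0 (trans (cong (λ a → X (k + + a)) (ℕₚ.+-identityʳ (3 ℕ.+ m))) l₃)
        (trans e (cong (λ a → k + + a) (sym (ℕₚ.+-identityʳ (3 ℕ.+ m))))) target

  snakeSize : SnakeStep → ℕ
  snakeSize E = 2
  snakeSize D = 3 ℕ.+ m

  coSize : CoStep → ℕ
  coSize S = 3 ℕ.+ (m ℕ.+ m)
  coSize L = 2 ℕ.+ (m ℕ.+ m)

  snakes : Mover X
  snakes = record
    { f = s ; type = σ ; size = snakeSize ; size>0 = λ { E → s≤s z≤n ; D → s≤s z≤n }
    ; f-step = step ; f-live = s-live ; injective = s-injective }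
    where
    step : ∀ {k} → Live k → s k ≡ k + + snakeSize (σ k)
    step {k} l with succView l
    ... | E _ e t   = trans e (cong (λ a → k + + snakeSize a) (sym t))
    ... | D _ _ e t = trans e (cong (λ a → k + + snakeSize a) (sym t))

  cosnakes : Mover X
  cosnakes = record
    { f = c ; type = γ ; size = coSize ; size>0 = λ { S → s≤s z≤n ; L → s≤s z≤n }
    ; f-step = step ; f-live = c-live ; injective = c-injective }
    where
    step : ∀ {k} → Live k → c k ≡ k + + coSize (γ k)
    step {k} l with cosuccView l
    ... | S _ e t   = trans e (cong (λ a → k + + coSize a) (sym t))
    ... | L _ _ e t = trans e (cong (λ a → k + + coSize a) (sym t))

  σ-c : ∀ {k} → Live k → σ (c k) ≡ σ k
  σ-c l = proj₁ (types-commute l)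

  γ-s : ∀ {k} → Live k → γ (s k) ≡ γ k
  γ-s l = proj₂ (types-commute l)

  linked : ∀ {u v} → Live u → Live v → ∃₂ λ a b → iterℤ s a u ≡ iterℤ c b v
  linked = Commuting.linked-all snakes cosnakes σ-c γ-s next-linked

-- Slithers, degrees and the theorem

divSafe-* : ∀ {c d} → 0 ℕ.< d → divSafe (c ℕ.* d) d ≡ c
divSafe-* {c} {suc d} _ = m*n/n≡m c (suc d)

eqSnake-refl : ∀ a → eqSnake a a ≡ true
eqSnake-refl E = refl
eqSnake-refl D = refl

eqSnake-sound : ∀ {a b} → eqSnake a b ≡ true → a ≡ b
eqSnake-sound {E} {E} _ = refl
eqSnake-sound {D} {D} _ = refl

eqCo-refl : ∀ a → eqCo a a ≡ true
eqCo-refl S = refl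
eqCo-refl L = refl

eqCo-sound : ∀ {a b} → eqCo a b ≡ true → a ≡ b
eqCo-sound {S} {S} _ = refl
eqCo-sound {L} {L} _ = refl

module TickerTape (m : ℕ) (x : Config (suc (suc m))) (ind : Independent (suc (suc m)) x) where

  private
    n = suc (suc m)
    X = tape n x

  open Dynamics m X (Tape.recurrence m x ind) (succ n x) (cosucc n x) (succType n x) (cosuccType n x)
    (λ _ → refl) (λ _ → refl) (λ _ → refl) (λ _ → refl)

  open CommutingPair snakes cosnakes (λ {k} → σ-c {k}) (λ {k} → γ-s {k}) (λ {u} {v} → linked {u} {v})

  private
    module F = Mover snakes
    module G = Mover cosnakes

  slither-tab : ∀ k N → slither n x k N ≡ tab (F.word k) N
  slither-tab k zero    = refl
  slither-tab k (suc N) = cong (succType n x k ∷_) (slither-tab (succ n x k) N)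

  coslither-tab : ∀ k N → coslither n x k N ≡ tab (G.word k) N
  coslither-tab k zero    = refl
  coslither-tab k (suc N) = cong (cosuccType n x k ∷_) (coslither-tab (cosucc n x k) N)

  X-shift-T : ∀ {T} → IsPeriodOf X T → ∀ k a → X (k + + T + a) ≡ X (k + a)
  X-shift-T {T} h k a = trans (cong X (ring k (+ T) a)) (h (k + a))
    where
    ring : ∀ k t a → k + t + a ≡ k + a + t
    ring = ℤ-Solver.solve-∀

  shift-difference : ∀ k d → k + + d - k ≡ + d
  shift-difference k d = ring k (+ d)
    where
    ring : ∀ k d → k + d - k ≡ d
    ring = ℤ-Solver.solve-∀

  module _ {T α β : ℕ} (minimal : IsMinPeriod X T) (αs : NumOrbits X (succ n x) α) (βs : NumOrbits X (cosucc n x) β)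
    {k : ℤ} (l : X k ≡ true) where

    private
      return-β : F.iter β k ≡ G.iter α k
      return-β = common-return αs βs {k} l

      -- After β steps k is back on its own co-snake, along which the types of snake steps are
      -- constant. Hence the slither is a full period of the type sequence, and its cyclic period is
      -- the least period of that sequence.
      word-periodic-β : Periodic (F.word k) β
      word-periodic-β = FG.F-word-linked {β} {α} l return-β

      word-periodic-α : Periodic (G.word k) α
      word-periodic-α = GF.F-word-linked {α} {β} l (sym return-β)

      leastP : LeastPeriod (F.word k) (lenP n x α β k)
      leastP = subst (λ w → LeastPeriod (F.word k) (cycPeriod eqSnake w)) (sym (slither-tab k β))
        (cycPeriod-least eqSnake eqSnake-refl eqSnake-sound {{ℕ.>-nonZero (FG-transitive.Count.N>0 βs {k} l)}} word-periodic-β)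

      leastQ : LeastPeriod (G.word k) (lenQ n x α β k)
      leastQ = subst (λ w → LeastPeriod (G.word k) (cycPeriod eqCo w)) (sym (coslither-tab k α))
        (cycPeriod-least eqCo eqCo-refl eqCo-sound {{ℕ.>-nonZero (GF-transitive.Count.N>0 αs {k} l)}} word-periodic-α)

      divSafe-exact : ∀ {N d} → 0 ℕ.< d → d ∣ N → N ≡ divSafe N d ℕ.* d
      divSafe-exact {d = d} 0<d (divides c refl) = cong (ℕ._* d) (sym (divSafe-* {c} 0<d))

      β≡ : β ≡ deg n x α β k ℕ.* lenP n x α β k
      β≡ = subst (λ N → β ≡ divSafe N (lenP n x α β k) ℕ.* lenP n x α β k)
        (sym (trans (cong length (slither-tab k β)) (length-tab (F.word k) β)))
        (divSafe-exact (LeastPeriod.positive leastP) (LeastPeriod.divides-period leastP word-periodic-β))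

      α≡ : α ≡ codeg n x α β k ℕ.* lenQ n x α β k
      α≡ = subst (λ N → α ≡ divSafe N (lenQ n x α β k) ℕ.* lenQ n x α β k)
        (sym (trans (cong length (coslither-tab k α)) (length-tab (G.word k) α)))
        (divSafe-exact (LeastPeriod.positive leastQ) (LeastPeriod.divides-period leastQ word-periodic-α))

      F-displacement : ∀ a → F.iter a k - k ≡ + F.disp a k
      F-displacement a = trans (cong (_- k) (F.iter-disp a l)) (shift-difference k (F.disp a k))

      G-displacement : ∀ a → G.iter a k - k ≡ + G.disp a k
      G-displacement a = trans (cong (_- k) (G.iter-disp a l)) (shift-difference k (G.disp a k))

    tape-period : (+ T ≡ gcd (pShift n x α β k) (qShift n x α β k))
                × (+ T * (+ deg n x α β k * + codeg n x α β k) ≡ Scale n x α β k)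
    tape-period =
      let X-T = proj₁ (proj₂ minimal)
          T≡gcd , product = minimal-period αs βs {k} l minimal
            -- Each type is read off one tape entry at a fixed offset, so it inherits the period T.
            (λ k → cong (if_then E else D) (X-shift-T X-T k (+ 2)))
            (λ k → cong (if_then S else L) (X-shift-T X-T k (+ (2 ℕ.* n ℕ.∸ 1))))
            leastP leastQ {deg n x α β k} {codeg n x α β k} β≡ α≡
      in trans (cong +_ T≡gcd) (sym (cong₂ gcd (F-displacement (lenP n x α β k)) (G-displacement (lenQ n x α β k))))
       , trans (cong (+ T *_) (sym (ℤₚ.pos-* (deg n x α β k) (codeg n x α β k))))
           (trans (sym (ℤₚ.pos-* T _)) (trans (cong +_ product) (sym (F-displacement β))))

theorem2p25 : (n : ℕ) .{{_ : NonZero n}} → 2 ≤ n →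
    (x : Config n) → Independent n x →
    (T α β : ℕ) →
    IsMinPeriod (tape n x) T →
    NumOrbits (tape n x) (succ n x) α →
    NumOrbits (tape n x) (cosucc n x) β →
    (k : ℤ) → tape n x k ≡ true →
    (+ T ≡ gcd (pShift n x α β k) (qShift n x α β k))
    × (+ T * (+ deg n x α β k * + codeg n x α β k) ≡ Scale n x α β k)
theorem2p25 (suc (suc m)) (s≤s (s≤s z≤n)) x ind T α β minimal αs βs k l =
  TickerTape.tape-period m x ind minimal αs βs l
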